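{- Let $n\ge 3$ be an integer and let $a,b,c\in\mathbb{Z}$ with $b^2=ac$. Let $f(X)=X^n+aX^2+2bX+c$ be irreducible with root $\theta$. If $p$ is a prime with $p\mid c$ and $p\nmid a$, then $p\mid I(\theta)$; in particular $f$ is non-monogenic.
   Context: Let $K=\mathbb{Q}(\theta)$ with ring of integers $\mathcal{O}_K$; $I(\theta)=[\mathcal{O}_K:\mathbb{Z}[\theta]]$ denotes the index. The polynomial $f$ is called monogenic if $I(\theta)=1$, i.e. $\mathbb{Z}[\theta]=\mathcal{O}_K$, and non-monogenic otherwise. Irreducible means irreducible over $\mathbb{Q}$. -}

module Defs where

open import Algebra.Apartness.Bundles using (HeytingField; module HeytingCommutativeRing)
open import Algebra.Bundles using (RawRing; RawSemiring; module CommutativeRing)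
import Algebra.Definitions.RawSemiring as RawSemiringDefs
open import Algebra.Morphism.Structures using (IsRingHomomorphism)
open import Data.Fin.Base using (Fin)
open import Data.Integer.Base as ℤ using (ℤ; +_)
open import Data.List.Base using (List; []; _∷_; map; foldr)
open import Data.Nat.Base as ℕ using (ℕ; zero; suc)
open import Data.Product.Base using (Σ; ∃; ∃₂; _×_; proj₁)
open import Data.Rational.Base as ℚ using (ℚ; _/_)
open import Function.Base using (_∘_)
open import Function.Definitions using (Bijective)
open import Level using (Level; _⊔_) renaming (suc to lsuc)
open import Relation.Binary.Core using (Rel)
open import Relation.Binary.PropositionalEquality.Core using (_≡_)
open import Relation.Unary using (Pred)

-- Univariate polynomials as coefficient lists, constant term first.  Trailing
-- zeros are permitted, so equality of polynomials is equality of all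
-- coefficients and not equality of lists.
module Polynomial {c ℓ} (R : RawRing c ℓ) where

  open RawRing R

  Poly : Set c
  Poly = List Carrier

  coeff : Poly → ℕ → Carrier
  coeff []      _       = 0#
  coeff (a ∷ p) zero    = a
  coeff (a ∷ p) (suc k) = coeff p k

  infix 4 _≈ₚ_
  _≈ₚ_ : Rel Poly ℓ
  p ≈ₚ q = ∀ k → coeff p k ≈ coeff q k

  infixl 6 _+ₚ_
  _+ₚ_ : Poly → Poly → Poly
  []      +ₚ q       = q
  (a ∷ p) +ₚ []      = a ∷ p
  (a ∷ p) +ₚ (b ∷ q) = (a + b) ∷ (p +ₚ q)

  infixl 7 _*ₚ_
  _*ₚ_ : Poly → Poly → Poly
  []      *ₚ q = []
  (a ∷ p) *ₚ q = map (a *_) q +ₚ (0# ∷ (p *ₚ q))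

  C : Carrier → Poly
  C a = a ∷ []

  X : Poly
  X = 0# ∷ 1# ∷ []

  polyRawSemiring : RawSemiring c ℓ
  polyRawSemiring = record
    { Carrier = Poly
    ; _≈_     = _≈ₚ_
    ; _+_     = _+ₚ_
    ; _*_     = _*ₚ_
    ; 0#      = []
    ; 1#      = C 1#
    }

  open RawSemiringDefs polyRawSemiring public using (_^_; Irreducible)

  Monic : Pred Poly ℓ
  Monic p = ∃ λ d → coeff p d ≈ 1# × (∀ {k} → d ℕ.< k → coeff p k ≈ 0#)

module ℤ[X] = Polynomial ℤ.+-*-rawRing
module ℚ[X] = Polynomial ℚ.+-*-rawRing

fromℤ : ℤ → ℚ
fromℤ i = i / 1

ℤ[X]⇒ℚ[X] : ℤ[X].Poly → ℚ[X].Poly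
ℤ[X]⇒ℚ[X] = map fromℤ

-- Xⁿ + aX² + 2bX + c
quadrinomial : ℕ → ℤ → ℤ → ℤ → ℤ[X].Poly
quadrinomial n a b c = X ^ n +ₚ C a *ₚ X ^ 2 +ₚ C (+ 2 ℤ.* b) *ₚ X +ₚ C c
  where open ℤ[X]

IrreducibleOverℚ : ℤ[X].Poly → Set
IrreducibleOverℚ f = ℚ[X].Irreducible (ℤ[X]⇒ℚ[X] f)

-- A field K = ℚ(θ) together with its chosen generator θ.
record SimpleExtension (k ℓ₁ ℓ₂ : Level) : Set (lsuc (k ⊔ ℓ₁ ⊔ ℓ₂)) where
  field
    heytingField : HeytingField k ℓ₁ ℓ₂

  open HeytingField heytingField public

  private
    rawRing : RawRing k ℓ₁
    rawRing = CommutativeRing.rawRing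
      (HeytingCommutativeRing.commutativeRing heytingCommutativeRing)

  field
    ι                : ℚ → Carrier
    ι-isHomomorphism : IsRingHomomorphism ℚ.+-*-rawRing rawRing ι
    θ                : Carrier

  evalℚ : ℚ[X].Poly → Carrier → Carrier
  evalℚ p x = foldr (λ a v → ι a + x * v) 0# p

  evalℤ : ℤ[X].Poly → Carrier → Carrier
  evalℤ = evalℚ ∘ ℤ[X]⇒ℚ[X]

  -- Every element is a quotient g(θ)/h(θ) with g, h ∈ ℚ[X].
  field
    generated : ∀ x → ∃₂ λ g h → evalℚ h θ # 0# × x * evalℚ h θ ≈ evalℚ g θ

  IsRoot : ℤ[X].Poly → Set ℓ₁
  IsRoot f = evalℤ f θ ≈ 0#

  IsIntegral : Pred Carrier ℓ₁
  IsIntegral x = ∃ λ g → ℤ[X].Monic g × evalℤ g x ≈ 0#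

  𝒪 : Set (k ⊔ ℓ₁)
  𝒪 = Σ Carrier IsIntegral

  ℤ[θ] : Pred Carrier ℓ₁
  ℤ[θ] x = ∃ λ g → x ≈ evalℤ g θ

  -- Equality in the additive quotient group 𝒪/ℤ[θ].
  infix 4 _∼_
  _∼_ : Rel 𝒪 ℓ₁
  x ∼ y = ℤ[θ] (proj₁ x - proj₁ y)

  -- IsIndex N says that [𝒪 : ℤ[θ]] = N, i.e. 𝒪/ℤ[θ] has exactly N elements.
  -- The index is a relation because its finiteness, which holds whenever θ is
  -- an algebraic integer, is not constructed here.
  IsIndex : ℕ → Set (k ⊔ ℓ₁)
  IsIndex N = ∃ λ (r : Fin N → 𝒪) → Bijective _≡_ _∼_ r

  -- For a monic irreducible f with root θ this is monogenicity of f.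
  Monogenic : Set (k ⊔ ℓ₁)
  Monogenic = IsIndex 1

{-# OPTIONS --safe #-}

-- Since p ∤ a, the relation b² = ac forces p ∣ b and p² ∣ c; write b = pb′ and c = p²c′.
-- Let u = θⁿ⁻¹ + aθ + 2b, so that θu = -c, and let x = u / p.  Then θx = -pc′, and
-- x² = 2b′x - ac′ - c′θⁿ⁻² times xⁿ⁻² is a monic equation for x over ℤ, so x ∈ 𝒪.
-- As 1, θ, …, θⁿ⁻¹ are linearly independent over ℚ, x ∉ ℤ[θ], whereas px = u ∈ ℤ[θ].
-- If 𝒪/ℤ[θ] has N elements, translation by x permutes them; comparing the sum of all the
-- elements with its translate gives Nx ∈ ℤ[θ], and then p ∣ N by Bézout.
module Submission where

open import Defs
open import Data.Nat.Base as ℕ using (ℕ; zero; suc; z≤n; s≤s)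
open import Data.Nat.Divisibility as ℕ using ()
open import Data.Nat.Primality using (Prime; euclidsLemma; prime⇒irreducible; prime⇒nonZero; ¬prime[1])
open import Data.Integer.Base as ℤ using (ℤ; +_; -[1+_])
open import Data.Integer.Divisibility as ℤ using ()
open import Data.Product.Base using (_×_; _,_; ∃; ∃₂; proj₁; proj₂)
open import Relation.Binary.PropositionalEquality.Core as ≡ using (_≡_; _≢_)
open import Relation.Nullary.Negation.Core using (¬_; contradiction)

open import Algebra.Apartness.Bundles using (module HeytingCommutativeRing)
open import Algebra.Bundles using (CommutativeRing)
open import Algebra.Definitions.RawMagma using (_,_)
import Algebra.Morphism.Construct.Composition as Composition
open import Algebra.Morphism.Structures using (IsRingHomomorphism)
import Algebra.Properties.CommutativeSemiring.Exp as Exp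
import Algebra.Solver.Ring as RingSolver
open import Algebra.Solver.Ring.AlmostCommutativeRing using (fromCommutativeRing; _-Raw-AlmostCommutative⟶_)
open import Data.Fin.Base as Fin using (Fin)
import Data.Fin.Permutation as Perm
open import Data.Integer.Divisibility.Signed using (∣ᵤ⇒∣; divides)
import Data.Integer.Properties as ℤ
import Data.Integer.Solver as ℤ
open import Data.List.Base using (List; []; _∷_; _++_; map; foldr; length)
open import Data.List.Membership.Propositional using (_∈_)
open import Data.List.Properties using (foldr-map)
open import Data.List.Relation.Unary.All as All using (All; []; _∷_)
import Data.List.Relation.Unary.All.Properties as All
open import Data.List.Relation.Unary.Any using (here; there)
open import Data.Maybe.Base as Maybe using (Maybe)
import Data.Nat.Coprimality as Coprimality
open import Data.Nat.GCD using (module Bézout)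
import Data.Nat.Properties as ℕ
open import Data.Rational.Base as ℚ using (ℚ; mkℚ; 0ℚ; 1ℚ; 1/_)
import Data.Rational.Properties as ℚ
open import Data.Sum.Base using (_⊎_; inj₁; inj₂; reduce)
open import Function.Base using (_∘_)
open import Level using (Level; _⊔_)
open import Relation.Binary.PropositionalEquality.Properties using (module ≡-Reasoning)
open import Relation.Nullary.Decidable.Core using (yes; no; dec⇒maybe)
open import Relation.Unary using (Pred)

-- `IsIndex` provides an enumeration of classes without any group structure on it, which is why the
-- order argument runs through a permutation and a sum. For translation to act on the classes, r + x
-- and r - x must lie in 𝒪 for every representative r, so sums and negatives of integral elements
-- have to be integral. The usual determinant argument for this is replaced by a division-free
-- elimination, which removes the generators of a finitely generated module stable under z until
-- only an equation for z remains. Of the two factors p in c, one pays for the denominator of x and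
-- leaves θx = -pc′; the other cancels the denominator that appears in x² = xu / p. The exponent in
-- xⁿ⁻² is chosen to pair every remaining θ with an x, since (θx)ⁿ⁻² is an integer.

-- Degree bounds, monic polynomials and division with remainder.

module PolynomialProperties {r ℓ} (R : CommutativeRing r ℓ) where

  open CommutativeRing R
  open Polynomial rawRing
  open import Algebra.Properties.Ring ring using (-‿distribˡ-*)
  open import Algebra.Properties.AbelianGroup +-abelianGroup using (xyx⁻¹≈y)
  open import Relation.Binary.Reasoning.Setoid setoid

  -- A strict bound in place of a degree: it asks for no decision whether a coefficient vanishes,
  -- and bound 0 describes exactly the zero polynomial.
  DegreeBelow : ℕ → Pred Poly ℓ
  DegreeBelow d p = ∀ k → d ℕ.≤ k → coeff p k ≈ 0#

  coeff-+ : ∀ p q k → coeff (p +ₚ q) k ≈ coeff p k + coeff q k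
  coeff-+ []      q       k       = sym (+-identityˡ _)
  coeff-+ (a ∷ p) []      k       = sym (+-identityʳ _)
  coeff-+ (a ∷ p) (b ∷ q) zero    = refl
  coeff-+ (a ∷ p) (b ∷ q) (suc k) = coeff-+ p q k

  coeff-map-* : ∀ a p k → coeff (map (a *_) p) k ≈ a * coeff p k
  coeff-map-* a []      k       = sym (zeroʳ a)
  coeff-map-* a (b ∷ p) zero    = refl
  coeff-map-* a (b ∷ p) (suc k) = coeff-map-* a p k

  coeff-∷-*-zero : ∀ a p q → coeff ((a ∷ p) *ₚ q) 0 ≈ a * coeff q 0
  coeff-∷-*-zero a p q = begin
    coeff (map (a *_) q +ₚ (0# ∷ p *ₚ q)) 0   ≈⟨ coeff-+ (map (a *_) q) _ 0 ⟩
    coeff (map (a *_) q) 0 + 0#               ≈⟨ +-identityʳ _ ⟩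
    coeff (map (a *_) q) 0                    ≈⟨ coeff-map-* a q 0 ⟩
    a * coeff q 0                             ∎

  coeff-∷-*-suc : ∀ a p q k →
    coeff ((a ∷ p) *ₚ q) (suc k) ≈ a * coeff q (suc k) + coeff (p *ₚ q) k
  coeff-∷-*-suc a p q k = begin
    coeff (map (a *_) q +ₚ (0# ∷ p *ₚ q)) (suc k)    ≈⟨ coeff-+ (map (a *_) q) _ (suc k) ⟩
    coeff (map (a *_) q) (suc k) + coeff (p *ₚ q) k  ≈⟨ +-congʳ (coeff-map-* a q (suc k)) ⟩
    a * coeff q (suc k) + coeff (p *ₚ q) k           ∎

  -- The zero polynomial may be a nonempty list of zeros, so the claim does not hold by computation.
  zero-*ₚ : ∀ p q → p ≈ₚ [] → p *ₚ q ≈ₚ []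
  zero-*ₚ []      q p≈0 k    = refl
  zero-*ₚ (a ∷ p) q p≈0 zero = begin
    coeff ((a ∷ p) *ₚ q) 0  ≈⟨ coeff-∷-*-zero a p q ⟩
    a * coeff q 0           ≈⟨ *-congʳ (p≈0 0) ⟩
    0# * coeff q 0          ≈⟨ zeroˡ _ ⟩
    0#                      ∎
  zero-*ₚ (a ∷ p) q p≈0 (suc k) = begin
    coeff ((a ∷ p) *ₚ q) (suc k)            ≈⟨ coeff-∷-*-suc a p q k ⟩
    a * coeff q (suc k) + coeff (p *ₚ q) k  ≈⟨ +-cong (*-congʳ (p≈0 0)) (zero-*ₚ p q (λ j → p≈0 (suc j)) k) ⟩
    0# * coeff q (suc k) + 0#               ≈⟨ +-identityʳ _ ⟩
    0# * coeff q (suc k)                    ≈⟨ zeroˡ _ ⟩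
    0#                                      ∎

  DegreeBelow-weaken : ∀ {d e} p → d ℕ.≤ e → DegreeBelow d p → DegreeBelow e p
  DegreeBelow-weaken p d≤e p<d k e≤k = p<d k (ℕ.≤-trans d≤e e≤k)

  DegreeBelow-+ : ∀ {d} p q → DegreeBelow d p → DegreeBelow d q → DegreeBelow d (p +ₚ q)
  DegreeBelow-+ p q p<d q<d k d≤k = begin
    coeff (p +ₚ q) k       ≈⟨ coeff-+ p q k ⟩
    coeff p k + coeff q k  ≈⟨ +-cong (p<d k d≤k) (q<d k d≤k) ⟩
    0# + 0#                ≈⟨ +-identityʳ 0# ⟩
    0#                     ∎

  DegreeBelow-map-* : ∀ {d} a p → DegreeBelow d p → DegreeBelow d (map (a *_) p)
  DegreeBelow-map-* a p p<d k d≤k =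
    trans (coeff-map-* a p k) (trans (*-congˡ (p<d k d≤k)) (zeroʳ a))

  DegreeBelow-C : ∀ a → DegreeBelow 1 (C a)
  DegreeBelow-C a (suc k) _ = refl

  DegreeBelow-length : ∀ p → DegreeBelow (length p) p
  DegreeBelow-length []      k       _         = refl
  DegreeBelow-length (a ∷ p) (suc k) (s≤s p≤k) = DegreeBelow-length p k p≤k

  DegreeBelow-pred : ∀ {d} p → DegreeBelow (suc d) p → coeff p d ≈ 0# → DegreeBelow d p
  DegreeBelow-pred {d} p p<1+d p[d]≈0 k d≤k with d ℕ.≟ k
  ... | yes ≡.refl = p[d]≈0
  ... | no  d≢k    = p<1+d k (ℕ.≤∧≢⇒< d≤k d≢k)

  DegreeBelow-* : ∀ {d e} p q → DegreeBelow (suc d) p → DegreeBelow (suc e) q →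
                  DegreeBelow (suc (d ℕ.+ e)) (p *ₚ q)
  DegreeBelow-* []      q p<d q<e k       _           = refl
  DegreeBelow-* {d} {e} (a ∷ p) q p<d q<e (suc k) (s≤s d+e≤k) = begin
    coeff ((a ∷ p) *ₚ q) (suc k)            ≈⟨ coeff-∷-*-suc a p q k ⟩
    a * coeff q (suc k) + coeff (p *ₚ q) k  ≈⟨ +-cong (*-congˡ (q<e (suc k) (s≤s (ℕ.≤-trans (ℕ.m≤n+m e d) d+e≤k))))
                                                      (tail d p<d d+e≤k) ⟩
    a * 0# + 0#                             ≈⟨ +-identityʳ _ ⟩
    a * 0#                                  ≈⟨ zeroʳ a ⟩
    0#                                      ∎
    where
    -- For d = 0 the induction hypothesis would need a degree below 0, but then `p` is the zero
    -- polynomial.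
    tail : ∀ d → DegreeBelow (suc d) (a ∷ p) → d ℕ.+ e ℕ.≤ k → coeff (p *ₚ q) k ≈ 0#
    tail zero    p<d _     = zero-*ₚ p q (λ j → p<d (suc j) (s≤s z≤n)) k
    tail (suc d) p<d d+e<k = DegreeBelow-* p q (λ j d≤j → p<d (suc j) (s≤s d≤j)) q<e k d+e<k

  -- Every other product of coefficients contributing to this position has an index above d or above
  -- e. The lemma serves both the monicity of products and, over ℚ, the additivity of degrees.
  coeff-*-top : ∀ {d e} p q → DegreeBelow (suc d) p → DegreeBelow (suc e) q →
                coeff (p *ₚ q) (d ℕ.+ e) ≈ coeff p d * coeff q e
  coeff-*-top []      q p<d q<e = sym (zeroˡ _)
  coeff-*-top {zero} {zero}  (a ∷ p) q p<d q<e = coeff-∷-*-zero a p q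
  coeff-*-top {zero} {suc e} (a ∷ p) q p<d q<e = begin
    coeff ((a ∷ p) *ₚ q) (suc e)            ≈⟨ coeff-∷-*-suc a p q e ⟩
    a * coeff q (suc e) + coeff (p *ₚ q) e  ≈⟨ +-congˡ (zero-*ₚ p q (λ j → p<d (suc j) (s≤s z≤n)) e) ⟩
    a * coeff q (suc e) + 0#                ≈⟨ +-identityʳ _ ⟩
    a * coeff q (suc e)                     ∎
  coeff-*-top {suc d} {e} (a ∷ p) q p<d q<e = begin
    coeff ((a ∷ p) *ₚ q) (suc (d ℕ.+ e))  ≈⟨ coeff-∷-*-suc a p q (d ℕ.+ e) ⟩
    a * coeff q (suc (d ℕ.+ e)) + coeff (p *ₚ q) (d ℕ.+ e)
      ≈⟨ +-cong (*-congˡ (q<e _ (s≤s (ℕ.m≤n+m e d))))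
                (coeff-*-top p q (λ j d≤j → p<d (suc j) (s≤s d≤j)) q<e) ⟩
    a * 0# + coeff p d * coeff q e        ≈⟨ +-congʳ (zeroʳ a) ⟩
    0# + coeff p d * coeff q e            ≈⟨ +-identityˡ _ ⟩
    coeff p d * coeff q e                 ∎

  -- The degree is an index here, unlike in `Monic`, because the remainder bound in `Division`
  -- refers to it.
  record MonicOfDegree (d : ℕ) (p : Poly) : Set ℓ where
    constructor monic
    field
      leading : coeff p d ≈ 1#
      bounded : DegreeBelow (suc d) p

  open MonicOfDegree public

  X-monic : MonicOfDegree 1 X
  X-monic = monic refl (λ { (suc (suc k)) _ → refl ; (suc zero) (s≤s ()) })

  *ₚ-monic : ∀ {d e p q} → MonicOfDegree d p → MonicOfDegree e q → MonicOfDegree (d ℕ.+ e) (p *ₚ q)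
  *ₚ-monic {p = p} {q} (monic p[d]≈1 p≤d) (monic q[e]≈1 q≤e) = monic
    (trans (coeff-*-top p q p≤d q≤e) (trans (*-cong p[d]≈1 q[e]≈1) (*-identityʳ 1#)))
    (DegreeBelow-* p q p≤d q≤e)

  X^-monic : ∀ n → MonicOfDegree n (X ^ n)
  X^-monic zero    = monic refl (DegreeBelow-C 1#)
  X^-monic (suc n) = *ₚ-monic X-monic (X^-monic n)

  +ₚ-monic : ∀ {d p q} → MonicOfDegree d p → DegreeBelow d q → MonicOfDegree d (p +ₚ q)
  +ₚ-monic {d} {p} {q} (monic p[d]≈1 p≤d) q<d = monic
    (begin
      coeff (p +ₚ q) d       ≈⟨ coeff-+ p q d ⟩
      coeff p d + coeff q d  ≈⟨ +-cong p[d]≈1 (q<d d ℕ.≤-refl) ⟩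
      1# + 0#                ≈⟨ +-identityʳ 1# ⟩
      1#                     ∎)
    (DegreeBelow-+ p q p≤d (DegreeBelow-weaken q (ℕ.n≤1+n d) q<d))

  record Division (f h : Poly) (d : ℕ) : Set (r ⊔ ℓ) where
    constructor division
    field
      quotient remainder : Poly
      equation           : f ≈ₚ quotient *ₚ h +ₚ remainder
      remainder-bound    : DegreeBelow d remainder

  -- The remainder of a ∷ f is a ∷ (remainder of f), reduced once more at its top coefficient t.
  divide : ∀ f {h d} → MonicOfDegree d h → Division f h d
  divide []      _ = division [] [] (λ _ → refl) (λ _ _ → refl)
  divide (a ∷ f) {h} {d} h-monic@(monic h[d]≈1 h≤d) with divide f h-monic
  ... | division q r f≈qh+r r<d = division (t ∷ q) r′ eq bound
    where
    t = coeff (a ∷ r) d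
    r′ = (a ∷ r) +ₚ map (- t *_) h

    coeff-r′ : ∀ k → coeff r′ k ≈ coeff (a ∷ r) k - t * coeff h k
    coeff-r′ k = begin
      coeff r′ k                                      ≈⟨ coeff-+ (a ∷ r) (map (- t *_) h) k ⟩
      coeff (a ∷ r) k + coeff (map (- t *_) h) k      ≈⟨ +-congˡ (coeff-map-* (- t) h k) ⟩
      coeff (a ∷ r) k + - t * coeff h k               ≈⟨ +-congˡ (-‿distribˡ-* t _) ⟨
      coeff (a ∷ r) k - t * coeff h k                 ∎

    cancel : ∀ x y → y ≈ x + (y - x)
    cancel x y = sym (trans (sym (+-assoc x y (- x))) (xyx⁻¹≈y x y))

    eq : (a ∷ f) ≈ₚ (t ∷ q) *ₚ h +ₚ r′
    eq zero = begin
      a                                             ≈⟨ cancel (t * coeff h 0) a ⟩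
      t * coeff h 0 + (a - t * coeff h 0)           ≈⟨ +-cong (coeff-∷-*-zero t q h) (coeff-r′ 0) ⟨
      coeff ((t ∷ q) *ₚ h) 0 + coeff r′ 0           ≈⟨ coeff-+ ((t ∷ q) *ₚ h) r′ 0 ⟨
      coeff ((t ∷ q) *ₚ h +ₚ r′) 0                  ∎
    eq (suc k) = begin
      coeff f k                                     ≈⟨ f≈qh+r k ⟩
      coeff (q *ₚ h +ₚ r) k                         ≈⟨ coeff-+ (q *ₚ h) r k ⟩
      coeff (q *ₚ h) k + coeff r k                  ≈⟨ +-congˡ (cancel th _) ⟩
      coeff (q *ₚ h) k + (th + (coeff r k - th))    ≈⟨ +-assoc _ _ _ ⟨
      coeff (q *ₚ h) k + th + (coeff r k - th)      ≈⟨ +-congʳ (+-comm _ _) ⟩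
      th + coeff (q *ₚ h) k + (coeff r k - th)      ≈⟨ +-cong (coeff-∷-*-suc t q h k) (coeff-r′ (suc k)) ⟨
      coeff ((t ∷ q) *ₚ h) (suc k) + coeff r′ (suc k) ≈⟨ coeff-+ ((t ∷ q) *ₚ h) r′ (suc k) ⟨
      coeff ((t ∷ q) *ₚ h +ₚ r′) (suc k)            ∎
      where th = t * coeff h (suc k)

    bound : DegreeBelow d r′
    bound = DegreeBelow-pred r′ r′≤d (begin
      coeff r′ d         ≈⟨ coeff-r′ d ⟩
      t - t * coeff h d  ≈⟨ +-congˡ (-‿cong (*-congˡ h[d]≈1)) ⟩
      t - t * 1#         ≈⟨ +-congˡ (-‿cong (*-identityʳ t)) ⟩
      t - t              ≈⟨ -‿inverseʳ t ⟩
      0#                 ∎)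
      where
      r′≤d = DegreeBelow-+ (a ∷ r) (map (- t *_) h) (λ { (suc k) (s≤s d≤k) → r<d k d≤k })
                           (DegreeBelow-map-* (- t) h h≤d)

-- Values of polynomials along a ring homomorphism.

module Evaluation
  {r ℓ s ℓ′} {R : CommutativeRing r ℓ} {S : CommutativeRing s ℓ′}
  {φ : CommutativeRing.Carrier R → CommutativeRing.Carrier S}
  (φ-isHomomorphism : IsRingHomomorphism
    (CommutativeRing.rawRing R) (CommutativeRing.rawRing S) φ)
  (x : CommutativeRing.Carrier S)
  where

  private module R = CommutativeRing R
  open CommutativeRing S
  open Polynomial R.rawRing renaming (_^_ to _^ₚ_)
  open IsRingHomomorphism φ-isHomomorphism
  open Exp commutativeSemiring using (_^_)
  open import Relation.Binary.Reasoning.Setoid setoid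
  open import Algebra.Properties.CommutativeSemigroup +-commutativeSemigroup using (interchange)
  open import Algebra.Properties.CommutativeSemigroup *-commutativeSemigroup using (x∙yz≈y∙xz)

  eval : Poly → Carrier
  eval = foldr (λ a v → φ a + x * v) 0#

  eval-+ : ∀ p q → eval (p +ₚ q) ≈ eval p + eval q
  eval-+ []      q       = sym (+-identityˡ _)
  eval-+ (a ∷ p) []      = sym (+-identityʳ _)
  eval-+ (a ∷ p) (b ∷ q) = begin
    φ (a R.+ b) + x * eval (p +ₚ q)            ≈⟨ +-cong (+-homo a b) (*-congˡ (eval-+ p q)) ⟩
    φ a + φ b + x * (eval p + eval q)          ≈⟨ +-congˡ (distribˡ x _ _) ⟩
    φ a + φ b + (x * eval p + x * eval q)      ≈⟨ interchange _ _ _ _ ⟩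
    φ a + x * eval p + (φ b + x * eval q)      ∎

  eval-map-* : ∀ a p → eval (map (a R.*_) p) ≈ φ a * eval p
  eval-map-* a []      = sym (zeroʳ _)
  eval-map-* a (b ∷ p) = begin
    φ (a R.* b) + x * eval (map (a R.*_) p)  ≈⟨ +-cong (*-homo a b) (*-congˡ (eval-map-* a p)) ⟩
    φ a * φ b + x * (φ a * eval p)           ≈⟨ +-congˡ (x∙yz≈y∙xz x _ _) ⟩
    φ a * φ b + φ a * (x * eval p)           ≈⟨ distribˡ _ _ _ ⟨
    φ a * (φ b + x * eval p)                 ∎

  eval-* : ∀ p q → eval (p *ₚ q) ≈ eval p * eval q
  eval-* []      q = sym (zeroˡ _)
  eval-* (a ∷ p) q = begin
    eval (map (a R.*_) q +ₚ (R.0# ∷ p *ₚ q))              ≈⟨ eval-+ (map (a R.*_) q) _ ⟩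
    eval (map (a R.*_) q) + (φ R.0# + x * eval (p *ₚ q))  ≈⟨ +-cong (eval-map-* a q) (+-cong 0#-homo (*-congˡ (eval-* p q))) ⟩
    φ a * eval q + (0# + x * (eval p * eval q))           ≈⟨ +-congˡ (trans (+-identityˡ _) (sym (*-assoc x _ _))) ⟩
    φ a * eval q + x * eval p * eval q                    ≈⟨ distribʳ _ _ _ ⟨
    (φ a + x * eval p) * eval q                           ∎

  -- The case of `eval-cong` in which one list outlasts the other: the excess consists of zeros.
  eval-zero : ∀ p → p ≈ₚ [] → eval p ≈ 0#
  eval-zero []      _   = refl
  eval-zero (a ∷ p) p≈0 = begin
    φ a + x * eval p  ≈⟨ +-cong (trans (⟦⟧-cong (p≈0 0)) 0#-homo) (*-congˡ (eval-zero p (λ k → p≈0 (suc k)))) ⟩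
    0# + x * 0#       ≈⟨ +-identityˡ _ ⟩
    x * 0#            ≈⟨ zeroʳ x ⟩
    0#                ∎

  eval-cong : ∀ p q → p ≈ₚ q → eval p ≈ eval q
  eval-cong []      q       p≈q = sym (eval-zero q (λ k → R.sym (p≈q k)))
  eval-cong (a ∷ p) []      p≈q = eval-zero (a ∷ p) p≈q
  eval-cong (a ∷ p) (b ∷ q) p≈q =
    +-cong (⟦⟧-cong (p≈q 0)) (*-congˡ (eval-cong p q (λ k → p≈q (suc k))))

  eval-C : ∀ a → eval (C a) ≈ φ a
  eval-C a = trans (+-congˡ (zeroʳ x)) (+-identityʳ _)

  eval-X : eval X ≈ x
  eval-X = begin
    φ R.0# + x * (eval (C R.1#))  ≈⟨ +-cong 0#-homo (*-congˡ (trans (eval-C R.1#) 1#-homo)) ⟩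
    0# + x * 1#                   ≈⟨ +-identityˡ _ ⟩
    x * 1#                        ≈⟨ *-identityʳ x ⟩
    x                             ∎

  eval-X^ : ∀ n → eval (X ^ₚ n) ≈ x ^ n
  eval-X^ zero    = trans (eval-C R.1#) 1#-homo
  eval-X^ (suc n) = trans (eval-* X (X ^ₚ n)) (*-cong eval-X (eval-X^ n))

  -- Used twice: over ℚ to descend among the polynomials vanishing at θ, and over ℤ to represent an
  -- element of `ℤ[θ]` by a polynomial of degree < n.
  eval-remainder : ∀ {f h d} (D : PolynomialProperties.Division R f h d) → eval h ≈ 0# →
                   eval (PolynomialProperties.Division.remainder D) ≈ eval f
  eval-remainder {f} {h} D h[x]≈0 = sym (begin
    eval f                        ≈⟨ eval-cong f (quotient *ₚ h +ₚ remainder) equation ⟩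
    eval (quotient *ₚ h +ₚ remainder)   ≈⟨ eval-+ (quotient *ₚ h) remainder ⟩
    eval (quotient *ₚ h) + eval remainder  ≈⟨ +-congʳ (eval-* quotient h) ⟩
    eval quotient * eval h + eval remainder  ≈⟨ +-congʳ (*-congˡ h[x]≈0) ⟩
    eval quotient * 0# + eval remainder      ≈⟨ +-congʳ (zeroʳ _) ⟩
    0# + eval remainder                      ≈⟨ +-identityˡ _ ⟩
    eval remainder                           ∎)
    where open PolynomialProperties.Division D

-- Integral elements and finitely generated modules over ℤ.

module IntegralElements
  {s ℓ} (S : CommutativeRing s ℓ) {φ : ℤ → CommutativeRing.Carrier S}
  (φ-isHomomorphism : IsRingHomomorphism ℤ.+-*-rawRing (CommutativeRing.rawRing S) φ)
  where

  open CommutativeRing S hiding (zero)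
  open IsRingHomomorphism φ-isHomomorphism
  open Exp commutativeSemiring using (_^_; ^-homo-*)
  open import Relation.Binary.Reasoning.Setoid setoid
  open import Algebra.Properties.Ring ring using (-0#≈0#)
  open PolynomialProperties ℤ.+-*-commutativeRing
  open Evaluation {R = ℤ.+-*-commutativeRing} {S = S} φ-isHomomorphism

  φ-morphism : ℤ.+-*-rawRing -Raw-AlmostCommutative⟶ fromCommutativeRing S
  φ-morphism = record
    { ⟦_⟧    = φ
    ; +-homo = +-homo
    ; *-homo = *-homo
    ; -‿homo = -‿homo
    ; 0-homo = 0#-homo
    ; 1-homo = 1#-homo
    }

  -- Only a sufficient test: `φ` is not assumed injective, so distinct integers settle nothing.
  φ-≟ : ∀ i j → Maybe (φ i ≈ φ j)
  φ-≟ i j = Maybe.map ⟦⟧-cong (dec⇒maybe (i ℤ.≟ j))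

  module Solver = RingSolver ℤ.+-*-rawRing (fromCommutativeRing S) φ-morphism φ-≟
  open Solver using (solve; con; _:=_; _:+_; _:*_; :-_; _:-_)

  private variable
    a b c         : Level
    A             : Pred Carrier a
    B             : Pred Carrier b
    T             : Pred Carrier c
    d e           : ℕ
    t v w x y z   : Carrier
    es fs         : List Carrier

  -- Coefficient domains are merely additive groups, such as ℤ or `ℤ[x]`; whatever closure under
  -- products a lemma requires is passed to it separately.
  record IsSubgroup (A : Pred Carrier a) : Set (s ⊔ ℓ ⊔ a) where
    field
      resp : v ≈ w → A v → A w
      0∈   : A 0#
      +∈   : A v → A w → A (v + w)
      -∈   : A v → A (- v)

  open IsSubgroup

  Integers : Pred Carrier ℓ
  Integers v = ∃ λ i → v ≈ φ i

  Integers-isSubgroup : IsSubgroup Integers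
  Integers-isSubgroup = record
    { resp = λ { v≈w (i , v≈i) → i , trans (sym v≈w) v≈i }
    ; 0∈   = + 0 , sym 0#-homo
    ; +∈   = λ { (i , v≈i) (j , w≈j) → i ℤ.+ j , trans (+-cong v≈i w≈j) (sym (+-homo i j)) }
    ; -∈   = λ { (i , v≈i) → ℤ.- i , trans (-‿cong v≈i) (sym (-‿homo i)) }
    }

  Integers-* : Integers v → Integers w → Integers (v * w)
  Integers-* (i , v≈i) (j , w≈j) = i ℤ.* j , trans (*-cong v≈i w≈j) (sym (*-homo i j))

  Integers-1 : Integers 1#
  Integers-1 = + 1 , sym 1#-homo

  Integers-φ : ∀ i → Integers (φ i)
  Integers-φ i = i , refl

  -- Below A z d consists of the values at z of the polynomials of degree < d with
  -- coefficients in A.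
  data Below (A : Pred Carrier a) (z : Carrier) : ℕ → Pred Carrier (s ⊔ ℓ ⊔ a) where
    zero : v ≈ 0# → Below A z 0 v
    suc  : A t → Below A z d w → v ≈ t + z * w → Below A z (suc d) v

  below-resp : v ≈ w → Below A z d v → Below A z d w
  below-resp v≈w (zero v≈0)    = zero (trans (sym v≈w) v≈0)
  below-resp v≈w (suc t∈ u∈ v≈) = suc t∈ u∈ (trans (sym v≈w) v≈)

  below-scale : (∀ {t} → A t → B (x * t)) → Below A z d v → Below B z d (x * v)
  below-scale {x = x} f (zero v≈0) = zero (trans (*-congˡ v≈0) (zeroʳ x))
  below-scale {x = x} {z = z} f (suc {t = t} {w = w} t∈ w∈ v≈) =
    suc (f t∈) (below-scale f w∈)
      (trans (*-congˡ v≈) (solve 4 (λ x t z w → x :* (t :+ z :* w) := x :* t :+ z :* (x :* w)) refl x t z w))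

  module _ (A-isSubgroup : IsSubgroup A) where

    below-0 : ∀ d → Below A z d 0#
    below-0 zero        = zero refl
    below-0 {z} (suc d) = suc (0∈ A-isSubgroup) (below-0 d)
      (sym (trans (+-identityˡ _) (zeroʳ z)))

    below-+ : Below A z d v → Below A z d w → Below A z d (v + w)
    below-+ (zero v≈0) (zero w≈0) = zero (trans (+-cong v≈0 w≈0) (+-identityʳ 0#))
    below-+ {z = z} (suc {t = t} {w = v′} t∈ v′∈ v≈) (suc {t = u} {w = w′} u∈ w′∈ w≈) =
      suc (+∈ A-isSubgroup t∈ u∈) (below-+ v′∈ w′∈)
        (trans (+-cong v≈ w≈)
          (solve 5 (λ z t v u w → t :+ z :* v :+ (u :+ z :* w) := t :+ u :+ z :* (v :+ w)) refl z t v′ u w′))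

    below-neg : Below A z d v → Below A z d (- v)
    below-neg (zero v≈0) = zero (trans (-‿cong v≈0) -0#≈0#)
    below-neg {z = z} (suc {t = t} {w = w} t∈ w∈ v≈) = suc (-∈ A-isSubgroup t∈) (below-neg w∈)
      (trans (-‿cong v≈) (solve 3 (λ z t w → :- (t :+ z :* w) := :- t :+ z :* (:- w)) refl z t w))

    below-isSubgroup : IsSubgroup (Below A z d)
    below-isSubgroup = record
      { resp = below-resp ; 0∈ = below-0 _ ; +∈ = below-+ ; -∈ = below-neg }

    below-coefficient : A v → Below A z (suc d) v
    below-coefficient {v} {z} v∈ = suc v∈ (below-0 _) (sym (trans (+-congˡ (zeroʳ z)) (+-identityʳ v)))

    below-shift : Below A z d v → Below A z (suc d) (z * v)
    below-shift v∈ = suc (0∈ A-isSubgroup) v∈ (sym (+-identityˡ _))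

    below-shifts : ∀ e → Below A z d v → Below A z (e ℕ.+ d) (z ^ e * v)
    below-shifts zero    v∈ = below-resp (sym (*-identityˡ _)) v∈
    below-shifts (suc e) v∈ = below-resp (sym (*-assoc _ _ _)) (below-shift (below-shifts e v∈))

    below-weaken : d ℕ.≤ e → Below A z d v → Below A z e v
    below-weaken {e = e} z≤n (zero v≈0) = below-resp (sym v≈0) (below-0 e)
    below-weaken (s≤s d≤e) (suc t∈ w∈ v≈) = suc t∈ (below-weaken d≤e w∈) v≈

    -- `suc` exposes the constant term, whereas reduction by a monic equation acts on the leading
    -- one.
    below-top : Below A z (suc d) v → ∃₂ λ w t → Below A z d w × A t × v ≈ w + t * z ^ d
    below-top {z} {v = v} (suc {t = t} t∈ (zero w≈0) v≈) = 0# , t , zero refl , t∈ , (begin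
      v              ≈⟨ v≈ ⟩
      t + z * _      ≈⟨ +-congˡ (*-congˡ w≈0) ⟩
      t + z * 0#     ≈⟨ +-congˡ (zeroʳ z) ⟩
      t + 0#         ≈⟨ +-comm t 0# ⟩
      0# + t         ≈⟨ +-congˡ (*-identityʳ t) ⟨
      0# + t * 1#    ∎)
    below-top {z} {suc d} {v} (suc {t = t} t∈ w∈@(suc _ _ _) v≈) with below-top w∈
    ... | w′ , u , w′∈ , u∈ , w≈ = t + z * w′ , u , suc t∈ w′∈ refl , u∈ ,
      trans v≈ (trans (+-congˡ (*-congˡ w≈))
        (solve 5 (λ z t w u p → t :+ z :* (w :+ u :* p) := t :+ z :* w :+ u :* (z :* p)) refl z t w′ u (z ^ d)))

    -- The equation of z may have coefficients in a smaller domain B than A. For sums of integral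
    -- elements, A is `ℤ[x]` while the equation of y stays over ℤ.
    below-reduce : (∀ {t u} → A t → B u → A (t * u)) → Below B z d (z ^ d) →
                   Below A z (suc d) v → Below A z d v
    below-reduce AB⊆A z^d∈ v∈ with below-top v∈
    ... | w , t , w∈ , t∈ , v≈ = below-resp (sym v≈) (below-+ w∈ (below-scale (AB⊆A t∈) z^d∈))

  below-* : IsSubgroup T → (∀ {t u} → A t → B u → T (t * u)) →
            Below A z d v → Below B z e w → Below T z (d ℕ.+ e) (v * w)
  below-* {e = e} T-sub AB⊆T (zero v≈0) w∈ =
    below-resp (sym (trans (*-congʳ v≈0) (zeroˡ _))) (below-0 T-sub e)
  below-* {z = z} {d = suc d} {e = e} {w = w} T-sub AB⊆T (suc {t = t} {w = v′} t∈ v′∈ v≈) w∈ =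
    below-resp
      (sym (trans (*-congʳ v≈) (solve 4 (λ t z v w → (t :+ z :* v) :* w := t :* w :+ z :* (v :* w)) refl t z v′ w)))
      (below-+ T-sub (below-weaken T-sub (ℕ.m≤n+m e (suc d)) (below-scale (AB⊆T t∈) w∈))
                     (below-shift T-sub (below-* T-sub AB⊆T v′∈ w∈)))

  -- Span A es consists of the A-linear combinations of 1 and the elements of es.
  data Span (A : Pred Carrier a) : List Carrier → Pred Carrier (s ⊔ ℓ ⊔ a) where
    []     : A v → Span A [] v
    _∷_by_ : A t → Span A es w → v ≈ t * y + w → Span A (y ∷ es) v

  span-resp : IsSubgroup A → v ≈ w → Span A es v → Span A es w
  span-resp A-sub v≈w ([] v∈)         = [] (resp A-sub v≈w v∈)
  span-resp A-sub v≈w (t∈ ∷ u∈ by v≈) = t∈ ∷ u∈ by trans (sym v≈w) v≈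

  span-scale : (∀ {t} → A t → B (x * t)) → Span A es v → Span B es (x * v)
  span-scale f ([] v∈) = [] (f v∈)
  span-scale {x = x} f (_∷_by_ {t = t} {w = w} {y = y} t∈ w∈ v≈) = f t∈ ∷ span-scale f w∈ by
    trans (*-congˡ v≈) (solve 4 (λ x t y w → x :* (t :* y :+ w) := x :* t :* y :+ x :* w) refl x t y w)

  span-⊆ : (∀ {t} → A t → B t) → Span A es v → Span B es v
  span-⊆ A⊆B ([] v∈)         = [] (A⊆B v∈)
  span-⊆ A⊆B (t∈ ∷ w∈ by v≈) = A⊆B t∈ ∷ span-⊆ A⊆B w∈ by v≈

  module _ (A-isSubgroup : IsSubgroup A) where

    span-∷ : Span A es v → Span A (y ∷ es) v
    span-∷ v∈ = 0∈ A-isSubgroup ∷ v∈ by sym (trans (+-congʳ (zeroˡ _)) (+-identityˡ _))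

    span-1 : A v → Span A es v
    span-1 {es = []}     v∈ = [] v∈
    span-1 {es = y ∷ es} v∈ = span-∷ (span-1 v∈)

    span-+ : Span A es v → Span A es w → Span A es (v + w)
    span-+ ([] v∈) ([] w∈) = [] (+∈ A-isSubgroup v∈ w∈)
    span-+ (_∷_by_ {t = t} {w = v′} {y = y} t∈ v′∈ v≈) (_∷_by_ {t = u} {w = w′} u∈ w′∈ w≈) =
      +∈ A-isSubgroup t∈ u∈ ∷ span-+ v′∈ w′∈ by
      trans (+-cong v≈ w≈)
        (solve 5 (λ t v y u w → t :* y :+ v :+ (u :* y :+ w) := (t :+ u) :* y :+ (v :+ w)) refl t v′ y u w′)

    span-member : y ∈ es → A t → Span A es (t * y)
    span-member (here ≡.refl) t∈ = t∈ ∷ span-1 (0∈ A-isSubgroup) by sym (+-identityʳ _)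
    span-member (there y∈)    t∈ = span-∷ (span-member y∈ t∈)

    span-++ˡ : Span A es v → Span A (es ++ fs) v
    span-++ˡ ([] v∈)         = span-1 v∈
    span-++ˡ (t∈ ∷ w∈ by v≈) = t∈ ∷ span-++ˡ w∈ by v≈

    span-++ʳ : ∀ es → Span A fs v → Span A (es ++ fs) v
    span-++ʳ []       v∈ = v∈
    span-++ʳ (_ ∷ es) v∈ = span-∷ (span-++ʳ es v∈)

    -- Multiplication by z carries the tacit generator 1 to z, which has to be listed from then on.
    span-map-* : ∀ z → Span A es v → Span A (map (z *_) es ++ z ∷ []) (z * v)
    span-map-* {v = v} z ([] v∈) =
      v∈ ∷ [] (0∈ A-isSubgroup) by trans (*-comm z v) (sym (+-identityʳ _))
    span-map-* z (_∷_by_ {t = t} {w = w} {y = y} t∈ w∈ v≈) = t∈ ∷ span-map-* z w∈ by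
      trans (*-congˡ v≈) (solve 4 (λ z t y w → z :* (t :* y :+ w) := t :* (z :* y) :+ z :* w) refl z t y w)

  -- `spans` and `members` are the two inclusions between A and the span of its generators; `1∈`
  -- belongs to the second one, since 1 is a tacit generator of every `Span`.
  record FinitelyGenerated (A : Pred Carrier a) : Set (s ⊔ ℓ ⊔ a) where
    field
      isSubgroup : IsSubgroup A
      1∈         : A 1#
      generators : List Carrier
      spans      : A v → Span Integers generators v
      members    : All A generators

  Integers-finitelyGenerated : FinitelyGenerated Integers
  Integers-finitelyGenerated = record
    { isSubgroup = Integers-isSubgroup
    ; 1∈         = Integers-1
    ; generators = []
    ; spans      = []
    ; members    = []
    }

  -- Over ℤ the products of powers of z with the generators of A suffice. The bound is a successor
  -- so that 1 is present; applying the lemma twice gives ℤ[x][y].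
  below-finitelyGenerated : ∀ z d → FinitelyGenerated A → FinitelyGenerated (Below A z (suc d))
  below-finitelyGenerated {A = A} z d A-fg = record
    { isSubgroup = below-isSubgroup isSubgroup
    ; 1∈         = 1∈′
    ; generators = gens d
    ; spans      = gens-span d
    ; members    = gens-members d
    }
    where
    open FinitelyGenerated A-fg

    1∈′ : Below A z (suc d) 1#
    1∈′ = below-coefficient isSubgroup 1∈

    gens : ℕ → List Carrier
    gens zero    = generators
    gens (suc d) = generators ++ map (z *_) (gens d) ++ z ∷ []

    gens-span : ∀ d → Below A z (suc d) v → Span Integers (gens d) v
    gens-span zero    (suc t∈ (zero w≈0) v≈) = spans (resp isSubgroup
      (sym (trans v≈ (trans (+-congˡ (trans (*-congˡ w≈0) (zeroʳ z))) (+-identityʳ _)))) t∈)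
    gens-span (suc d) (suc t∈ w∈ v≈) = span-resp Integers-isSubgroup (sym v≈)
      (span-+ Integers-isSubgroup
        (span-++ˡ Integers-isSubgroup (spans t∈))
        (span-++ʳ Integers-isSubgroup generators (span-map-* Integers-isSubgroup z (gens-span d w∈))))

    gens-members : ∀ d → All (Below A z (suc d)) (gens d)
    gens-members zero    = All.map (below-coefficient isSubgroup) members
    gens-members (suc d) = All.++⁺ (All.map (below-coefficient isSubgroup) members)
      (All.++⁺ (All.map⁺ (All.map (below-shift isSubgroup) (gens-members d)))
        (below-resp (*-identityʳ z) (below-shift isSubgroup (below-coefficient isSubgroup 1∈)) ∷ []))

  -- A monic equation of degree d solved for its leading power, the form in which reductions use it.
  Integral : Pred Carrier (s ⊔ ℓ)
  Integral z = ∃ λ d → Below Integers z d (z ^ d)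

  -- Fraction-free elimination: if zᵈ e = v e + s with deg v < d, multiplying the relation of
  -- every other generator by the monic zᵈ - v removes e and doubles d.
  eliminate : ∀ z d es → Span (Below Integers z d) es (z ^ d * 1#) →
              (∀ {y} → y ∈ es → Span (Below Integers z d) es (z ^ d * y)) → Integral z
  -- Without generators the span is the coefficient domain itself, so the relation kept for 1 is
  -- already an equation for z.
  eliminate z d []       ([] z^d∈) _  = d , below-resp (*-identityʳ _) z^d∈
  eliminate z d (e ∷ es) rel₁ rel with rel (here ≡.refl)
  ... | _∷_by_ {t = v} {w = s} v∈ s∈ z^de≈ =
    eliminate z (d ℕ.+ d) es
      (step (λ t∈ → span-resp sub (sym (*-identityʳ _)) (span-1 sub t∈)) rel₁)
      (λ y∈ → step (span-member sub y∈) (rel (there y∈)))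
    where
    sub : IsSubgroup (Below Integers z (d ℕ.+ d))
    sub = below-isSubgroup Integers-isSubgroup

    mul : ∀ {t u} → Below Integers z d t → Below Integers z d u → Below Integers z (d ℕ.+ d) (t * u)
    mul = below-* Integers-isSubgroup Integers-*

    -- The new relation contains y itself with coefficient zᵈv of degree < 2d. The argument `y∈`
    -- absorbs this term, y being 1 or one of the remaining generators.
    step : ∀ {y} → (∀ {t} → Below Integers z (d ℕ.+ d) t → Span (Below Integers z (d ℕ.+ d)) es (t * y)) →
           Span (Below Integers z d) (e ∷ es) (z ^ d * y) →
           Span (Below Integers z (d ℕ.+ d)) es (z ^ (d ℕ.+ d) * y)
    step {y} y∈ (_∷_by_ {t = w} {w = s′} w∈ s′∈ z^dy≈) = span-resp sub (sym identity)
      (span-+ sub (y∈ (below-shifts Integers-isSubgroup d v∈))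
      (span-+ sub (span-scale (mul w∈) s∈)
      (span-+ sub (span-scale (below-shifts Integers-isSubgroup d) s′∈)
                  (span-scale (mul (below-neg Integers-isSubgroup v∈)) s′∈))))
      where
      p = z ^ d
      identity : z ^ (d ℕ.+ d) * y ≈ p * v * y + (w * s + (p * s′ + - v * s′))
      identity = begin
        z ^ (d ℕ.+ d) * y                            ≈⟨ *-congʳ (^-homo-* z d d) ⟩
        p * p * y                                    ≈⟨ *-assoc p p y ⟩
        p * (p * y)                                  ≈⟨ *-congˡ z^dy≈ ⟩
        p * (w * e + s′)                             ≈⟨ solve 4 (λ p w e s′ → p :* (w :* e :+ s′) := w :* (p :* e) :+ p :* s′) refl p w e s′ ⟩
        w * (p * e) + p * s′                         ≈⟨ +-congʳ (*-congˡ z^de≈) ⟩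
        w * (v * e + s) + p * s′
          ≈⟨ solve 6 (λ p w e s s′ v → w :* (v :* e :+ s) :+ p :* s′
                                    := v :* (w :* e :+ s′) :+ (w :* s :+ (p :* s′ :+ :- v :* s′))) refl p w e s s′ v ⟩
        v * (w * e + s′) + (w * s + (p * s′ + - v * s′))  ≈⟨ +-congʳ (*-congˡ z^dy≈) ⟨
        v * (p * y) + (w * s + (p * s′ + - v * s′))
          ≈⟨ +-congʳ (solve 3 (λ v p y → v :* (p :* y) := p :* v :* y) refl v p y) ⟩
        p * v * y + (w * s + (p * s′ + - v * s′))    ∎

  -- Stability expresses z times each generator, and z times 1, by integer coefficients. These have
  -- degree < 1 in z, so the elimination starts at d = 1.
  finitelyGenerated⇒integral : FinitelyGenerated A → (∀ {v} → A v → A (z * v)) → Integral z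
  finitelyGenerated⇒integral {A = A} {z = z} A-fg zA⊆A =
    eliminate z 1 generators (relation 1∈) (λ y∈ → relation (All.lookup members y∈))
    where
    open FinitelyGenerated A-fg

    relation : ∀ {y} → A y → Span (Below Integers z 1) generators (z ^ 1 * y)
    relation y∈ = span-⊆ (below-coefficient Integers-isSubgroup)
      (span-resp Integers-isSubgroup (*-congʳ (sym (*-identityʳ z))) (spans (zA⊆A y∈)))

  module _ (x-integral : Integral x) where

    private
      m : ℕ
      m = proj₁ x-integral

      x^m∈ : Below Integers x m (x ^ m)
      x^m∈ = proj₂ x-integral

      -- One power more than the equation of degree m calls for, so that 1 belongs to it for every
      -- m.
      ℤ[x] : Pred Carrier (s ⊔ ℓ)
      ℤ[x] = Below Integers x (suc m)

      ℤ[x]-fg : FinitelyGenerated ℤ[x]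
      ℤ[x]-fg = below-finitelyGenerated x m Integers-finitelyGenerated

      ℤ[x]-sub : IsSubgroup ℤ[x]
      ℤ[x]-sub = FinitelyGenerated.isSubgroup ℤ[x]-fg

      x*∈ : ℤ[x] v → ℤ[x] (x * v)
      x*∈ v∈ = below-reduce Integers-isSubgroup Integers-* (below-shift Integers-isSubgroup x^m∈)
                 (below-shift Integers-isSubgroup v∈)

      ℤ[x]-Integers-* : ℤ[x] v → Integers w → ℤ[x] (v * w)
      ℤ[x]-Integers-* v∈ w∈ =
        below-resp (*-comm _ _) (below-scale (λ t∈ → Integers-* w∈ t∈) v∈)

    integral-neg : Integral (- x)
    integral-neg = finitelyGenerated⇒integral ℤ[x]-fg λ {v} v∈ →
      below-resp (solve 2 (λ x v → :- (x :* v) := :- x :* v) refl x v)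
        (below-neg Integers-isSubgroup (x*∈ v∈))

    -- ℤ[x][y] is spanned by finitely many products of powers of x and y, and it is stable under
    -- both factors, hence under their sum.
    integral-+ : Integral y → Integral (x + y)
    integral-+ {y} (e , y^e∈) = finitelyGenerated⇒integral (below-finitelyGenerated y e ℤ[x]-fg) λ v∈ →
      below-resp (sym (distribʳ _ x y)) (below-+ ℤ[x]-sub
        (below-scale x*∈ v∈)
        (below-reduce ℤ[x]-sub ℤ[x]-Integers-* (below-shift Integers-isSubgroup y^e∈)
          (below-shift ℤ[x]-sub v∈)))

  -- Split off the leading power. This lemma and its converse keep the lower part on the same side;
  -- their users supply the sign.
  monic⇒below : ∀ x d g → MonicOfDegree d g → ∃ λ w → Below Integers x d w × eval x g ≈ x ^ d + w
  monic⇒below x d       []      (monic () _)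
  monic⇒below x zero    (i ∷ g) (monic i≡1 g≤0) = 0# , zero refl ,
    +-cong (trans (⟦⟧-cong i≡1) 1#-homo)
      (trans (*-congˡ (eval-zero x g (λ k → g≤0 (suc k) (s≤s z≤n)))) (zeroʳ x))
  monic⇒below x (suc d) (i ∷ g) (monic g[d]≡1 g≤d)
    with monic⇒below x d g (monic g[d]≡1 (λ k d<k → g≤d (suc k) (s≤s d<k)))
  ... | w , w∈ , g≈ = φ i + x * w , suc (Integers-φ i) w∈ refl ,
    trans (+-congˡ (*-congˡ g≈))
      (solve 4 (λ i x p w → i :+ x :* (p :+ w) := x :* p :+ (i :+ x :* w)) refl (φ i) x (x ^ d) w)

  below⇒monic : Below Integers x d w → ∃ λ g → MonicOfDegree d g × eval x g ≈ x ^ d + w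
  below⇒monic {x} (zero w≈0) = + 1 ∷ [] , monic ≡.refl (λ { (suc k) _ → ≡.refl }) ,
    +-cong 1#-homo (trans (zeroʳ x) (sym w≈0))
  below⇒monic {x} {suc d} (suc {w = w} (i , t≈i) w∈ v≈) with below⇒monic w∈
  ... | g , monic g[d]≡1 g≤d , g≈ = i ∷ g , monic g[d]≡1 (λ { (suc k) (s≤s d<k) → g≤d k d<k }) ,
    trans (+-congˡ (*-congˡ g≈))
      (trans (solve 4 (λ i x p w → i :+ x :* (p :+ w) := x :* p :+ (i :+ x :* w)) refl (φ i) x (x ^ d) w)
             (+-congˡ (sym (trans v≈ (+-congʳ t≈i)))))

-- The embedding of ℤ into ℚ.

-- `i / 1` is normalised through a gcd and stays stuck for a variable i; the explicit fraction on
-- the right computes.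
fromℤ-mkℚ : ∀ i → fromℤ i ≡ mkℚ i 0 (Coprimality.sym (Coprimality.1-coprimeTo ℤ.∣ i ∣))
fromℤ-mkℚ i = ℚ.↥p/↧p≡p (mkℚ i 0 (Coprimality.sym (Coprimality.1-coprimeTo ℤ.∣ i ∣)))

fromℤ-injective : ∀ {i j} → fromℤ i ≡ fromℤ j → i ≡ j
fromℤ-injective {i} {j} eq =
  ≡.cong ℚ.numerator (≡.trans (≡.sym (fromℤ-mkℚ i)) (≡.trans eq (fromℤ-mkℚ j)))

fromℤ-isHomomorphism : IsRingHomomorphism ℤ.+-*-rawRing ℚ.+-*-rawRing fromℤ
fromℤ-isHomomorphism = record
  { isSemiringHomomorphism = record
    { isNearSemiringHomomorphism = record
      { +-isMonoidHomomorphism = record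
        { isMagmaHomomorphism = record
          { isRelHomomorphism = record { cong = ≡.cong fromℤ }
          ; homo = +-homo
          }
        ; ε-homo = ≡.refl
        }
      ; *-homo = *-homo
      }
    ; 1#-homo = ≡.refl
    }
  ; -‿homo = -‿homo
  }
  where
  open ℤ.+-*-Solver
  +-homo : ∀ i j → fromℤ (i ℤ.+ j) ≡ fromℤ i ℚ.+ fromℤ j
  +-homo i j rewrite fromℤ-mkℚ i | fromℤ-mkℚ j =
    ≡.cong fromℤ (solve 2 (λ i j → i :+ j := i :* con (+ 1) :+ j :* con (+ 1)) ≡.refl i j)

  *-homo : ∀ i j → fromℤ (i ℤ.* j) ≡ fromℤ i ℚ.* fromℤ j
  *-homo i j rewrite fromℤ-mkℚ i | fromℤ-mkℚ j = ≡.refl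

  -‿homo : ∀ i → fromℤ (ℤ.- i) ≡ ℚ.- fromℤ i
  -‿homo i rewrite fromℤ-mkℚ i | fromℤ-mkℚ (ℤ.- i) with i
  ... | + zero   = ≡.refl
  ... | + suc _  = ≡.refl
  ... | -[1+ _ ] = ≡.refl

coeff-map-fromℤ : ∀ f k → ℚ[X].coeff (ℤ[X]⇒ℚ[X] f) k ≡ fromℤ (ℤ[X].coeff f k)
coeff-map-fromℤ []      k       = ≡.refl
coeff-map-fromℤ (a ∷ f) zero    = ≡.refl
coeff-map-fromℤ (a ∷ f) (suc k) = coeff-map-fromℤ f k

-- Units and roots of irreducible polynomials over ℚ.

module PolynomialsOverℚ where

  open ℚ[X]
  open PolynomialProperties ℚ.+-*-commutativeRing

  *-nonZero : ∀ {p q} → p ≢ 0ℚ → q ≢ 0ℚ → p ℚ.* q ≢ 0ℚ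
  *-nonZero {p} {q} p≢0 q≢0 pq≡0 = q≢0 (begin
    q                      ≡⟨ ℚ.*-identityˡ q ⟨
    1ℚ ℚ.* q               ≡⟨ ≡.cong (ℚ._* q) (ℚ.*-inverseˡ p) ⟨
    1/ p ℚ.* p ℚ.* q       ≡⟨ ℚ.*-assoc (1/ p) p q ⟩
    1/ p ℚ.* (p ℚ.* q)     ≡⟨ ≡.cong (1/ p ℚ.*_) pq≡0 ⟩
    1/ p ℚ.* 0ℚ            ≡⟨ ℚ.*-zeroʳ (1/ p) ⟩
    0ℚ                     ∎)
    where
    open ≡-Reasoning
    instance _ = ℚ.≢-nonZero p≢0

  -- Equality on ℚ is decidable, so a search downwards from any bound finds the exact degree.
  leadingTerm : ∀ d p → DegreeBelow d p →
                p ≈ₚ [] ⊎ ∃ λ e → coeff p e ≢ 0ℚ × DegreeBelow (suc e) p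
  leadingTerm zero    p p<0 = inj₁ (λ k → p<0 k z≤n)
  leadingTerm (suc d) p p≤d with coeff p d ℚ.≟ 0ℚ
  ... | yes p[d]≡0 = leadingTerm d p (DegreeBelow-pred p p≤d p[d]≡0)
  ... | no  p[d]≢0 = inj₂ (d , p[d]≢0 , p≤d)

  -- Degrees add over a field: a q of positive degree would give the product a nonzero coefficient
  -- at a positive position.
  unit⇒constant : ∀ s q → s *ₚ q ≈ₚ C 1ℚ → DegreeBelow 1 q
  unit⇒constant s q sq≈1
    with leadingTerm _ s (DegreeBelow-length s) | leadingTerm _ q (DegreeBelow-length q)
  ... | inj₁ s≈0              | _                          =
    contradiction (≡.trans (≡.sym (sq≈1 0)) (zero-*ₚ s q s≈0 0)) λ ()
  ... | inj₂ _                | inj₁ q≈0                   = λ k _ → q≈0 k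
  ... | inj₂ _                | inj₂ (zero , _ , q≤0)      = q≤0
  ... | inj₂ (d , s[d]≢0 , s≤d) | inj₂ (suc e , q[e]≢0 , q≤e) =
    contradiction
      (≡.trans (≡.sym (coeff-*-top s q s≤d q≤e))
        (≡.trans (sq≈1 (d ℕ.+ suc e))
                 (DegreeBelow-C 1ℚ (d ℕ.+ suc e) (ℕ.≤-trans (s≤s z≤n) (ℕ.m≤n+m (suc e) d)))))
      (*-nonZero s[d]≢0 q[e]≢0)

  module Roots
    {s ℓ} (S : CommutativeRing s ℓ) {ι : ℚ → CommutativeRing.Carrier S}
    (ι-isHomomorphism : IsRingHomomorphism ℚ.+-*-rawRing (CommutativeRing.rawRing S) ι)
    (1≉0 : ¬ CommutativeRing._≈_ S (CommutativeRing.1# S) (CommutativeRing.0# S))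
    (x : CommutativeRing.Carrier S)
    where

    private module S = CommutativeRing S
    open S using (_≈_; 0#; 1#)
    open Evaluation {R = ℚ.+-*-commutativeRing} {S = S} ι-isHomomorphism x

    unit-nonRoot : ∀ s h → s *ₚ h ≈ₚ C 1ℚ → ¬ eval h ≈ 0#
    unit-nonRoot s h sh≈1 h[x]≈0 = 1≉0 (begin
      1#                       ≈⟨ 1#-homo ⟨
      ι 1ℚ                     ≈⟨ eval-C 1ℚ ⟨
      eval (C 1ℚ)              ≈⟨ eval-cong (s *ₚ h) (C 1ℚ) sh≈1 ⟨
      eval (s *ₚ h)            ≈⟨ eval-* s h ⟩
      eval s S.* eval h        ≈⟨ S.*-congˡ h[x]≈0 ⟩
      eval s S.* 0#            ≈⟨ S.zeroʳ _ ⟩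
      0#                       ∎)
      where
      open IsRingHomomorphism ι-isHomomorphism
      open import Relation.Binary.Reasoning.Setoid S.setoid

    module _
      {n : ℕ} {f : Poly} (f-monic : MonicOfDegree n f) (f-irreducible : Irreducible f)
      (f[x]≈0 : eval f ≈ 0#)
      where

      -- The division of f by a nonzero h vanishing at x leaves a smaller remainder vanishing
      -- at x, which is 0 by induction; then h divides the irreducible f.
      smallDegreeRoot⇒zero : ∀ d h → d ℕ.≤ n → DegreeBelow d h → eval h ≈ 0# → h ≈ₚ []
      smallDegreeRoot⇒zero zero    h _   h<0 _      = λ k → h<0 k z≤n
      smallDegreeRoot⇒zero (suc d) h d<n h≤d h[x]≈0 with coeff h d ℚ.≟ 0ℚ
      ... | yes h[d]≡0 = smallDegreeRoot⇒zero d h (ℕ.<⇒≤ d<n) (DegreeBelow-pred h h≤d h[d]≡0) h[x]≈0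
      ... | no  h[d]≢0 = contradiction (Irreducible.split-∣1 f-irreducible f≈qh′) λ
        { (inj₁ (s , sq≈1))  → quotient-nonUnit s sq≈1
        ; (inj₂ (s , sh′≈1)) → unit-nonRoot s h′ sh′≈1 h′[x]≈0
        }
        where
        instance _ = ℚ.≢-nonZero h[d]≢0
        c = 1/ coeff h d
        h′ = map (c ℚ.*_) h

        h′-monic : MonicOfDegree d h′
        h′-monic = monic (≡.trans (coeff-map-* c h d) (ℚ.*-inverseˡ (coeff h d)))
                         (DegreeBelow-map-* c h h≤d)

        h′[x]≈0 : eval h′ ≈ 0#
        h′[x]≈0 = S.trans (eval-map-* c h) (S.trans (S.*-congˡ h[x]≈0) (S.zeroʳ _))

        f/h′ = divide f h′-monic
        open Division f/h′ renaming (quotient to q; remainder to r)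

        r≈0 : r ≈ₚ []
        r≈0 = smallDegreeRoot⇒zero d r (ℕ.<⇒≤ d<n) remainder-bound
                (S.trans (eval-remainder f/h′ h′[x]≈0) f[x]≈0)

        f≈qh′ : f ≈ₚ q *ₚ h′
        f≈qh′ k = ≡.trans (equation k) (≡.trans (coeff-+ (q *ₚ h′) r k)
          (≡.trans (≡.cong (coeff (q *ₚ h′) k ℚ.+_) (r≈0 k)) (ℚ.+-identityʳ _)))

        -- A unit quotient is constant, so q h′ has degree at most d < n, against the coefficient 1
        -- of Xⁿ in f.
        quotient-nonUnit : ∀ s → ¬ s *ₚ q ≈ₚ C 1ℚ
        quotient-nonUnit s sq≈1 = contradiction
          (≡.trans (≡.sym (leading f-monic))
            (≡.trans (f≈qh′ n)
              (DegreeBelow-* q h′ (unit⇒constant s q sq≈1) (bounded h′-monic) n d<n)))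
          λ ()

-- Translations of a finite quotient and the order of a class.

module Translation
  {s ℓ} (S : CommutativeRing s ℓ) {φ : ℤ → CommutativeRing.Carrier S}
  (φ-isHomomorphism : IsRingHomomorphism ℤ.+-*-rawRing (CommutativeRing.rawRing S) φ)
  where

  open CommutativeRing S hiding (zero)
  open IntegralElements S φ-isHomomorphism
  open IsSubgroup
  open Solver using (solve; _:=_; _:+_; :-_; _:-_)
  open import Algebra.Properties.CommutativeMonoid.Sum +-commutativeMonoid
    using (sum; sum-permute; sum-cong-≋; ∑-distrib-+; sum-replicate)
  open import Algebra.Properties.Monoid.Mult +-monoid
    using (×-assocˡ; ×-congˡ) renaming (_×_ to _·_)
  open import Relation.Binary.Reasoning.Setoid setoid

  module _ {a} {L : Pred Carrier a} (L-isSubgroup : IsSubgroup L) where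

    sum∈ : ∀ {N} (t : Fin N → Carrier) → (∀ i → L (t i)) → L (sum t)
    sum∈ {zero}  t t∈ = 0∈ L-isSubgroup
    sum∈ {suc N} t t∈ = +∈ L-isSubgroup (t∈ Fin.zero) (sum∈ (λ i → t (Fin.suc i)) (λ i → t∈ (Fin.suc i)))

    multiple∈ : ∀ n {x} → L x → L (n · x)
    multiple∈ zero    x∈ = 0∈ L-isSubgroup
    multiple∈ (suc n) x∈ = +∈ L-isSubgroup x∈ (multiple∈ n x∈)

    -- Translation by x permutes the classes modulo L of the r i, so their sum s satisfies
    -- s ≡ s + N · x modulo L.
    translation⇒multiple∈ : ∀ {N} (r : Fin N → Carrier) → (∀ {i j} → L (r i - r j) → i ≡ j) →
      ∀ x (σ τ : Fin N → Fin N) →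
      (∀ i → L (r (σ i) - (r i + x))) → (∀ i → L (r (τ i) - (r i + - x))) → L (N · x)
    translation⇒multiple∈ {N} r r-injective x σ τ σ-shifts τ-shifts =
      resp L-isSubgroup (sym N·x≈) (-∈ L-isSubgroup (sum∈ δ σ-shifts))
      where
      -- Shifting by -y and then by y returns to the class of `r i`, and distinct indices have
      -- distinct classes. The shift y is arbitrary because the opposite composite is the same claim
      -- at -x.
      inverse : ∀ y (σ τ : Fin N → Fin N) → (∀ i → L (r (σ i) - (r i + y))) →
                (∀ i → L (r (τ i) - (r i + - y))) → ∀ i → σ (τ i) ≡ i
      inverse y σ τ σ-shifts τ-shifts i = r-injective (resp L-isSubgroup
        (solve 4 (λ a b c y → a :- (b :+ y) :+ (b :- (c :+ :- y)) := a :- c) refl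
          (r (σ (τ i))) (r (τ i)) (r i) y)
        (+∈ L-isSubgroup (σ-shifts (τ i)) (τ-shifts i)))

      π : Perm.Permutation N N
      π = Perm.permutation σ τ (inverse x σ τ σ-shifts τ-shifts)
        (inverse (- x) τ σ τ-shifts (λ i → resp L-isSubgroup
          (solve 3 (λ a b x → a :- (b :+ x) := a :- (b :+ :- (:- x))) refl (r (σ i)) (r i) x)
          (σ-shifts i)))

      -- The translate `r i + x` is only congruent to the chosen representative; δ records the
      -- discrepancy, which lies in L.
      δ : Fin N → Carrier
      δ i = r (σ i) - (r i + x)

      N·x≈ : N · x ≈ - sum δ
      N·x≈ = begin
        N · x                                 ≈⟨ solve 3 (λ d s m → m := :- d :+ (d :+ (s :+ m)) :- s) refl (sum δ) (sum r) (N · x) ⟩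
        - sum δ + (sum δ + (sum r + N · x)) - sum r  ≈⟨ +-congʳ (+-congˡ total) ⟨
        - sum δ + sum r - sum r               ≈⟨ solve 2 (λ d s → :- d :+ s :- s := :- d) refl (sum δ) (sum r) ⟩
        - sum δ                               ∎
        where
        total : sum r ≈ sum δ + (sum r + N · x)
        total = begin
          sum r                                ≈⟨ sum-permute r π ⟩
          sum (λ i → r (σ i))                  ≈⟨ sum-cong-≋ (λ i → solve 2 (λ a b → a := a :- b :+ b) refl (r (σ i)) (r i + x)) ⟩
          sum (λ i → δ i + (r i + x))          ≈⟨ ∑-distrib-+ δ (λ i → r i + x) ⟩
          sum δ + sum (λ i → r i + x)          ≈⟨ +-congˡ (∑-distrib-+ r (λ _ → x)) ⟩
          sum δ + (sum r + sum {N} (λ _ → x))  ≈⟨ +-congˡ (+-congˡ (sum-replicate N)) ⟩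
          sum δ + (sum r + N · x)              ∎

    -- If p does not divide N, the two are coprime and a Bézout combination of p · x and N · x
    -- equals x, which would then lie in L.
    order-divides : ∀ {p N x} → Prime p → L (p · x) → ¬ L x → L (N · x) → p ℕ.∣ N
    order-divides {p} {N} {x} p-prime p·x∈ x∉ N·x∈ with p ℕ.∣? N
    ... | yes p∣N = p∣N
    ... | no  p∤N = contradiction x∈ x∉
      where
      coprime : Coprimality.Coprime p N
      coprime (d∣p , d∣N) with prime⇒irreducible p-prime d∣p
      ... | inj₁ d≡1    = d≡1
      ... | inj₂ ≡.refl = contradiction d∣N p∤N

      -- Over ℕ Bézout's identity has two forms, according to which multiple is larger, so m and n
      -- must be able to exchange p and N.
      difference∈ : ∀ {m n} k l → 1 ℕ.+ l ℕ.* n ≡ k ℕ.* m → L (m · x) → L (n · x) → L x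
      difference∈ {m} {n} k l eq m·x∈ n·x∈ = resp L-isSubgroup
        (begin
          (k · (m · x)) - (l · (n · x))                    ≈⟨ +-congʳ (×-assocˡ x k m) ⟩
          (k ℕ.* m) · x - (l · (n · x))                    ≈⟨ +-congʳ (×-congˡ eq) ⟨
          x + (l ℕ.* n) · x - (l · (n · x))                ≈⟨ +-congʳ (+-congˡ (×-assocˡ x l n)) ⟨
          x + l · (n · x) - l · (n · x)                    ≈⟨ solve 2 (λ x y → x :+ y :- y := x) refl x (l · (n · x)) ⟩
          x                                                ∎)
        (+∈ L-isSubgroup (multiple∈ k m·x∈) (-∈ L-isSubgroup (multiple∈ l n·x∈)))

      x∈ : L x
      x∈ with Coprimality.coprime-Bézout coprime
      ... | Bézout.+- k l eq = difference∈ k l eq p·x∈ N·x∈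
      ... | Bézout.-+ k l eq = difference∈ l k eq N·x∈ p·x∈

-- Divisibility of b and c by powers of p.

-- As p ∣ b², also p ∣ b. Cancelling one p from b² = ac gives b (b/p) = a (c/p); p divides the left
-- side and not a, so it divides c/p.
prime-squares : ∀ {p a b c} → Prime p → b ℕ.* b ≡ a ℕ.* c → p ℕ.∣ c → ¬ p ℕ.∣ a →
                p ℕ.∣ b × p ℕ.* p ℕ.∣ c
prime-squares {p} {a} {b} {c} p-prime bb≡ac p∣c@(ℕ.divides r c≡rp) p∤a
  with reduce (euclidsLemma b b p-prime (≡.subst (p ℕ.∣_) (≡.sym bb≡ac) (ℕ.∣n⇒∣m*n a p∣c)))
... | p∣b@(ℕ.divides q b≡qp) = p∣b , ≡.subst (p ℕ.* p ℕ.∣_) (≡.sym c≡rp) (ℕ.*-monoˡ-∣ p p∣r)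
  where
  instance _ = prime⇒nonZero p-prime

  b*q≡a*r : b ℕ.* q ≡ a ℕ.* r
  b*q≡a*r = ℕ.*-cancelʳ-≡ (b ℕ.* q) (a ℕ.* r) p (begin
    b ℕ.* q ℕ.* p      ≡⟨ ℕ.*-assoc b q p ⟩
    b ℕ.* (q ℕ.* p)    ≡⟨ ≡.cong (b ℕ.*_) b≡qp ⟨
    b ℕ.* b            ≡⟨ bb≡ac ⟩
    a ℕ.* c            ≡⟨ ≡.cong (a ℕ.*_) c≡rp ⟩
    a ℕ.* (r ℕ.* p)    ≡⟨ ℕ.*-assoc a r p ⟨
    a ℕ.* r ℕ.* p      ∎)
    where open ≡-Reasoning

  p∣r : p ℕ.∣ r
  p∣r with euclidsLemma a r p-prime (≡.subst (p ℕ.∣_) b*q≡a*r (ℕ.∣m⇒∣m*n q p∣b))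
  ... | inj₁ p∣a = contradiction p∣a p∤a
  ... | inj₂ p∣r = p∣r

prime-squaresℤ : ∀ {p a b c} → Prime p → b ℤ.* b ≡ a ℤ.* c → + p ℤ.∣ c → ¬ + p ℤ.∣ a →
                 (∃ λ b′ → b ≡ b′ ℤ.* + p) × (∃ λ c′ → c ≡ c′ ℤ.* (+ p ℤ.* + p))
prime-squaresℤ {p} {a} {b} {c} p-prime bb≡ac p∣c p∤a
  with prime-squares p-prime (≡.trans (≡.sym (ℤ.abs-* b b)) (≡.trans (≡.cong ℤ.∣_∣ bb≡ac) (ℤ.abs-* a c))) p∣c p∤a
... | p∣b , p²∣c
  with ∣ᵤ⇒∣ {+ p} {b} p∣b | ∣ᵤ⇒∣ {+ p ℤ.* + p} {c} (≡.subst (ℕ._∣ ℤ.∣ c ∣) (≡.sym (ℤ.abs-* (+ p) (+ p))) p²∣c)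
... | divides b′ b≡ | divides c′ c≡ = (b′ , b≡) , (c′ , c≡)

module _ where
  open ℤ[X]
  open PolynomialProperties ℤ.+-*-commutativeRing

  -- `3 ≤ n` keeps aX² strictly below Xⁿ.
  quadrinomial-monic : ∀ n a b c → 3 ℕ.≤ n → MonicOfDegree n (quadrinomial n a b c)
  quadrinomial-monic n a b c 3≤n =
    +ₚ-monic
      (+ₚ-monic
        (+ₚ-monic (X^-monic n)
          (DegreeBelow-weaken (C a *ₚ X ^ 2) 3≤n
            (DegreeBelow-* (C a) (X ^ 2) (DegreeBelow-C a) (bounded (X^-monic 2)))))
        (DegreeBelow-weaken (C (+ 2 ℤ.* b) *ₚ X) (ℕ.≤-trans (ℕ.n≤1+n 2) 3≤n)
          (DegreeBelow-* (C (+ 2 ℤ.* b)) X (DegreeBelow-C _) (bounded X-monic))))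
      (DegreeBelow-weaken (C c) (ℕ.≤-trans (s≤s z≤n) 3≤n) (DegreeBelow-C c))

map-fromℤ-degreeBelow : ∀ {d} f →
  PolynomialProperties.DegreeBelow ℤ.+-*-commutativeRing d f →
  PolynomialProperties.DegreeBelow ℚ.+-*-commutativeRing d (ℤ[X]⇒ℚ[X] f)
map-fromℤ-degreeBelow f f<d k d≤k = ≡.trans (coeff-map-fromℤ f k) (≡.cong fromℤ (f<d k d≤k))

map-fromℤ-monic : ∀ {d f} →
  PolynomialProperties.MonicOfDegree ℤ.+-*-commutativeRing d f →
  PolynomialProperties.MonicOfDegree ℚ.+-*-commutativeRing d (ℤ[X]⇒ℚ[X] f)
map-fromℤ-monic {d} {f} (PolynomialProperties.monic f[d]≡1 f≤d) = PolynomialProperties.monic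
  (≡.trans (coeff-map-fromℤ f d) (≡.cong fromℤ f[d]≡1)) (map-fromℤ-degreeBelow f f≤d)

-- The order ℤ[θ] in the field K.

module Extension {ℓ₀ ℓ₁ ℓ₂} (K : SimpleExtension ℓ₀ ℓ₁ ℓ₂) where

  open SimpleExtension K
    using (heytingCommutativeRing; #-irrefl; invertible⇒#; ι; ι-isHomomorphism; θ
          ; evalℤ; IsRoot; IsIntegral; 𝒪; ℤ[θ]; IsIndex)
  open HeytingCommutativeRing heytingCommutativeRing using (commutativeRing)
  open CommutativeRing commutativeRing hiding (zero)
  open Exp commutativeSemiring using (_^_; ^-congˡ; ^-distrib-*)
  open import Algebra.Properties.Monoid.Mult +-monoid using () renaming (_×_ to _·_)
  open import Algebra.Properties.Ring ring using (-0#≈0#)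
  open import Relation.Binary.Reasoning.Setoid setoid

  -- The difference 1 - 0 is invertible, so 1 is apart from 0, and apartness excludes equality.
  1≉0 : ¬ 1# ≈ 0#
  1≉0 1≈0 = #-irrefl 1≈0 (invertible⇒# (1# , trans (*-identityˡ _) 1-0≈1 , trans (*-identityʳ _) 1-0≈1))
    where
    1-0≈1 : 1# - 0# ≈ 1#
    1-0≈1 = trans (+-congˡ -0#≈0#) (+-identityʳ 1#)

  φ : ℤ → Carrier
  φ = ι ∘ fromℤ

  φ-isHomomorphism : IsRingHomomorphism ℤ.+-*-rawRing rawRing φ
  φ-isHomomorphism = Composition.isRingHomomorphism trans fromℤ-isHomomorphism ι-isHomomorphism

  open IsRingHomomorphism φ-isHomomorphism
  open IntegralElements commutativeRing φ-isHomomorphism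
  open Translation commutativeRing φ-isHomomorphism
  open Evaluation {R = ℤ.+-*-commutativeRing} {S = commutativeRing} φ-isHomomorphism
  open PolynomialProperties ℤ.+-*-commutativeRing
  open Solver using (solve; con; _:=_; _:+_; _:*_; :-_; _:-_)

  -- `evalℤ` passes through polynomials over ℚ; fusing the two traversals makes evaluation along `φ`
  -- applicable.
  evalℤ≡eval : ∀ g x → evalℤ g x ≡ eval x g
  evalℤ≡eval g x = foldr-map _ fromℤ 0# g

  isIntegral⇒integral : ∀ {x} → IsIntegral x → Integral x
  isIntegral⇒integral {x} (g , (d , g[d]≡1 , g≤d) , g[x]≈0)
    with monic⇒below x d g (monic g[d]≡1 (λ k → g≤d))
  ... | w , w∈ , g≈ = d , below-resp
    (begin
      - w                 ≈⟨ solve 2 (λ p w → :- w := p :- (p :+ w)) refl (x ^ d) w ⟩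
      x ^ d - (x ^ d + w) ≈⟨ +-congˡ (-‿cong g≈) ⟨
      x ^ d - eval x g    ≈⟨ +-congˡ (-‿cong (trans (reflexive (≡.sym (evalℤ≡eval g x))) g[x]≈0)) ⟩
      x ^ d - 0#          ≈⟨ +-congˡ -0#≈0# ⟩
      x ^ d + 0#          ≈⟨ +-identityʳ _ ⟩
      x ^ d               ∎)
    (below-neg Integers-isSubgroup w∈)

  integral⇒isIntegral : ∀ {x} → Integral x → IsIntegral x
  integral⇒isIntegral {x} (d , x^d∈) with below⇒monic (below-neg Integers-isSubgroup x^d∈)
  ... | g , monic g[d]≡1 g≤d , g≈ = g , (d , g[d]≡1 , λ {k} → g≤d k) ,
    trans (reflexive (evalℤ≡eval g x)) (trans g≈ (-‿inverseʳ _))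

  ℤ[θ]-isSubgroup : IsSubgroup ℤ[θ]
  ℤ[θ]-isSubgroup = record
    { resp = λ { v≈w (g , v≈) → g , trans (sym v≈w) v≈ }
    ; 0∈   = [] , refl
    ; +∈   = λ { (g , v≈) (h , w≈) → (g +ₚ h) , trans (+-cong (trans v≈ (≡eval g)) (trans w≈ (≡eval h)))
                                       (trans (sym (eval-+ θ g h)) (sym (≡eval (g +ₚ h)))) }
    ; -∈   = λ { {v} (g , v≈) → map (ℤ.-1ℤ ℤ.*_) g , (begin
        - v                               ≈⟨ -‿cong (trans v≈ (≡eval g)) ⟩
        - eval θ g                        ≈⟨ solve 1 (λ v → :- v := con ℤ.-1ℤ :* v) refl (eval θ g) ⟩
        φ ℤ.-1ℤ * eval θ g                ≈⟨ eval-map-* θ ℤ.-1ℤ g ⟨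
        eval θ (map (ℤ.-1ℤ ℤ.*_) g)       ≈⟨ ≡eval (map (ℤ.-1ℤ ℤ.*_) g) ⟨
        evalℤ (map (ℤ.-1ℤ ℤ.*_) g) θ      ∎) }
    }
    where
    open ℤ[X] using (_+ₚ_)
    ≡eval : ∀ g → evalℤ g θ ≈ eval θ g
    ≡eval g = reflexive (evalℤ≡eval g θ)

  module _ {N} (index : IsIndex N) where

    representative : Fin N → 𝒪
    representative = proj₁ index

    -- Surjectivity of the enumeration names the class of the translate, once closure under addition
    -- has placed that translate in 𝒪.
    translate : ∀ {y} → Integral y → ∀ i → ∃ λ j → ℤ[θ] (proj₁ (representative j) - (proj₁ (representative i) + y))
    translate {y} y-integral i = proj₁ preimage , proj₂ preimage ≡.refl
      where
      preimage = proj₂ (proj₂ index) (proj₁ (representative i) + y ,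
        integral⇒isIntegral (integral-+ (isIntegral⇒integral (proj₂ (representative i))) y-integral))

    index-multiple : ∀ {x} → Integral x → ℤ[θ] (N · x)
    index-multiple {x} x-integral =
      translation⇒multiple∈ ℤ[θ]-isSubgroup (proj₁ ∘ representative) (proj₁ (proj₂ index)) x
        (proj₁ ∘ translate x-integral) (proj₁ ∘ translate (integral-neg x-integral))
        (proj₂ ∘ translate x-integral) (proj₂ ∘ translate (integral-neg x-integral))

  index-divisible : ∀ {p N x} → Prime p → Integral x → ℤ[θ] (p · x) → ¬ ℤ[θ] x → IsIndex N → p ℕ.∣ N
  index-divisible p-prime x-integral p·x∈ x∉ index =
    order-divides ℤ[θ]-isSubgroup p-prime p·x∈ x∉ (index-multiple index x-integral)

  φ-· : ∀ n x → φ (+ n) * x ≈ n · x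
  φ-· zero    x = trans (*-congʳ 0#-homo) (zeroˡ x)
  φ-· (suc n) x = begin
    φ (+ 1 ℤ.+ + n) * x        ≈⟨ *-congʳ (+-homo (+ 1) (+ n)) ⟩
    (φ (+ 1) + φ (+ n)) * x    ≈⟨ solve 2 (λ n x → (con (+ 1) :+ n) :* x := x :+ n :* x) refl (φ (+ n)) x ⟩
    x + φ (+ n) * x            ≈⟨ +-congˡ (φ-· n x) ⟩
    x + n · x                  ∎

  below-power : ∀ x d → Below Integers x (suc d) (x ^ d)
  below-power x zero    = below-coefficient Integers-isSubgroup Integers-1
  below-power x (suc d) = below-shift Integers-isSubgroup (below-power x d)

  Integers-^ : ∀ {v} n → Integers v → Integers (v ^ n)
  Integers-^ zero    v∈ = Integers-1
  Integers-^ (suc n) v∈ = Integers-* v∈ (Integers-^ n v∈)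

  -- The integral element x = u / p outside ℤ[θ].

  module NonMonogenic (m : ℕ) (a b′ c′ : ℤ) (p : ℕ) (p-prime : Prime p) where

    private
      k n : ℕ
      k = suc m
      n = suc (suc k)

      b c : ℤ
      b = b′ ℤ.* + p
      c = c′ ℤ.* (+ p ℤ.* + p)

      f : ℤ[X].Poly
      f = quadrinomial n a b c

    module _ (f-irreducible : IrreducibleOverℚ f) (f[θ]≈0 : IsRoot f) where

      f-monic : MonicOfDegree n f
      f-monic = quadrinomial-monic n a b c (s≤s (s≤s (s≤s z≤n)))

      A B′ C′ P : Carrier
      A  = φ a
      B′ = φ b′
      C′ = φ c′
      P  = φ (+ p)

      -- The quotient of f - c by X; its degree `suc k` is n - 1.
      u-poly : ℤ[X].Poly
      u-poly = X ^ₚ suc k +ₚ (C a *ₚ X +ₚ C (+ 2 ℤ.* b))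
        where open ℤ[X] renaming (_^_ to _^ₚ_)

      p≢0 : fromℤ (+ p) ≢ 0ℚ
      p≢0 eq = ℕ.≢-nonZero⁻¹ p {{prime⇒nonZero p-prime}} (ℤ.+-injective (fromℤ-injective eq))

      instance
        p-nonZero : ℚ.NonZero (fromℤ (+ p))
        p-nonZero = ℚ.≢-nonZero p≢0

      P⁻¹ : Carrier
      P⁻¹ = ι (1/ fromℤ (+ p))

      P⁻¹P≈1 : P⁻¹ * P ≈ 1#
      P⁻¹P≈1 = trans (sym (ι.*-homo _ _)) (trans (ι.⟦⟧-cong (ℚ.*-inverseˡ (fromℤ (+ p)))) ι.1#-homo)
        where module ι = IsRingHomomorphism ι-isHomomorphism

      -- Identities about the fraction x are multiplied by p, proved as ring identities in u, and
      -- cancelled again.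
      P-cancel : ∀ {v w} → P * v ≈ P * w → v ≈ w
      P-cancel {v} {w} eq = begin
        v              ≈⟨ P⁻¹P* v ⟨
        P⁻¹ * (P * v)  ≈⟨ *-congˡ eq ⟩
        P⁻¹ * (P * w)  ≈⟨ P⁻¹P* w ⟩
        w              ∎
        where
        P⁻¹P* : ∀ v → P⁻¹ * (P * v) ≈ v
        P⁻¹P* v = trans (sym (*-assoc _ _ _)) (trans (*-congʳ P⁻¹P≈1) (*-identityˡ v))

      u x : Carrier
      u = θ ^ suc k + (A * θ + φ (+ 2) * (B′ * P))
      x = P⁻¹ * u

      Px≈u : P * x ≈ u
      Px≈u = trans (sym (*-assoc _ _ _)) (trans (*-congʳ (trans (*-comm P P⁻¹) P⁻¹P≈1)) (*-identityˡ u))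

      2b-homo : φ (+ 2 ℤ.* b) ≈ φ (+ 2) * (B′ * P)
      2b-homo = trans (*-homo (+ 2) b) (*-congˡ (*-homo b′ (+ p)))

      eval-u : eval θ u-poly ≈ u
      eval-u = trans (eval-+ θ (X ^ₚ suc k) _) (+-cong (eval-X^ θ (suc k))
        (trans (eval-+ θ (C a *ₚ X) (C (+ 2 ℤ.* b)))
          (+-cong (trans (eval-* θ (C a) X) (*-cong (eval-C θ a) (eval-X θ)))
                  (trans (eval-C θ (+ 2 ℤ.* b)) 2b-homo))))
        where open ℤ[X] renaming (_^_ to _^ₚ_)

      eval-f : eval θ f ≈ θ * θ ^ suc k + A * (θ * (θ * 1#)) + φ (+ 2) * (B′ * P) * θ + C′ * (P * P)
      eval-f = trans (eval-+ θ (X ^ₚ n +ₚ C a *ₚ X ^ₚ 2 +ₚ C (+ 2 ℤ.* b) *ₚ X) (C c)) (+-cong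
        (trans (eval-+ θ (X ^ₚ n +ₚ C a *ₚ X ^ₚ 2) (C (+ 2 ℤ.* b) *ₚ X)) (+-cong
          (trans (eval-+ θ (X ^ₚ n) (C a *ₚ X ^ₚ 2)) (+-cong (eval-X^ θ n)
            (trans (eval-* θ (C a) (X ^ₚ 2)) (*-cong (eval-C θ a) (eval-X^ θ 2)))))
          (trans (eval-* θ (C (+ 2 ℤ.* b)) X) (*-cong (trans (eval-C θ (+ 2 ℤ.* b)) 2b-homo) (eval-X θ)))))
        (trans (eval-C θ c) (trans (*-homo c′ _) (*-congˡ (*-homo (+ p) (+ p))))))
        where open ℤ[X] renaming (_^_ to _^ₚ_)

      eval-f≈0 : eval θ f ≈ 0#
      eval-f≈0 = trans (reflexive (≡.sym (evalℤ≡eval f θ))) f[θ]≈0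

      θx≈ : θ * x ≈ - (P * C′)
      θx≈ = P-cancel (begin
        P * (θ * x)   ≈⟨ solve 3 (λ p t x → p :* (t :* x) := t :* (p :* x)) refl P θ x ⟩
        θ * (P * x)   ≈⟨ *-congˡ Px≈u ⟩
        θ * u         ≈⟨ solve 6 (λ t q a b p c →
                           t :* (q :+ (a :* t :+ con (+ 2) :* (b :* p)))
                           := (t :* q :+ a :* (t :* (t :* con (+ 1))) :+ con (+ 2) :* (b :* p) :* t :+ c :* (p :* p))
                              :+ p :* (:- (p :* c))) refl θ (θ ^ suc k) A B′ P C′ ⟩
        -- The constant 1 enters the ring identity as the image of an integer, while `eval-f` has
        -- the unit of K.
        θ * θ ^ suc k + A * (θ * (θ * φ (+ 1))) + φ (+ 2) * (B′ * P) * θ + C′ * (P * P) + P * (- (P * C′))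
                      ≈⟨ +-congʳ (+-congʳ (+-congʳ (+-congˡ (*-congˡ (*-congˡ (*-congˡ 1#-homo)))))) ⟩
        θ * θ ^ suc k + A * (θ * (θ * 1#)) + φ (+ 2) * (B′ * P) * θ + C′ * (P * P) + P * (- (P * C′))
                      ≈⟨ +-congʳ eval-f ⟨
        eval θ f + P * (- (P * C′))  ≈⟨ +-congʳ eval-f≈0 ⟩
        0# + P * (- (P * C′))        ≈⟨ +-identityˡ _ ⟩
        P * (- (P * C′))             ∎)

      -- In px² = xu, taking one θ out of θⁿ⁻¹ + aθ leaves (θᵏ + a)(θx) + 2bx. Both θx and b carry a
      -- factor p, so p cancels.
      x²≈ : x * x ≈ φ (+ 2) * B′ * x - A * C′ - C′ * θ ^ k
      x²≈ = P-cancel (begin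
        P * (x * x)   ≈⟨ solve 2 (λ p x → p :* (x :* x) := x :* (p :* x)) refl P x ⟩
        x * (P * x)   ≈⟨ *-congˡ Px≈u ⟩
        x * u         ≈⟨ solve 6 (λ t q a b p x →
                           x :* (t :* q :+ (a :* t :+ con (+ 2) :* (b :* p)))
                           := (q :+ a) :* (t :* x) :+ p :* (con (+ 2) :* b :* x)) refl θ (θ ^ k) A B′ P x ⟩
        (θ ^ k + A) * (θ * x) + P * (φ (+ 2) * B′ * x)        ≈⟨ +-congʳ (*-congˡ θx≈) ⟩
        (θ ^ k + A) * (- (P * C′)) + P * (φ (+ 2) * B′ * x)
          ≈⟨ solve 6 (λ q a p c b x →
               (q :+ a) :* (:- (p :* c)) :+ p :* (con (+ 2) :* b :* x)
               := p :* (con (+ 2) :* b :* x :- a :* c :- c :* q)) refl (θ ^ k) A P C′ B′ x ⟩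
        P * (φ (+ 2) * B′ * x - A * C′ - C′ * θ ^ k)          ∎)

      -- x is a root of Xⁿ - 2b′Xⁿ⁻¹ + ac′Xⁿ⁻² + c′(-pc′)ⁿ⁻².
      x^n≈ : x ^ n ≈ φ (+ 2) * B′ * x ^ suc k + - (A * C′) * x ^ k + - (C′ * (- (P * C′)) ^ k)
      x^n≈ = begin
        x * (x * x ^ k)                                        ≈⟨ *-assoc x x _ ⟨
        x * x * x ^ k                                          ≈⟨ *-congʳ x²≈ ⟩
        (φ (+ 2) * B′ * x - A * C′ - C′ * θ ^ k) * x ^ k
          ≈⟨ solve 6 (λ b x a c t q → (con (+ 2) :* b :* x :- a :* c :- c :* t) :* q
               := con (+ 2) :* b :* (x :* q) :+ :- (a :* c) :* q :+ :- (c :* (t :* q))) refl B′ x A C′ (θ ^ k) (x ^ k) ⟩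
        lower + - (C′ * (θ ^ k * x ^ k))                       ≈⟨ +-congˡ (-‿cong (*-congˡ (^-distrib-* θ x k))) ⟨
        lower + - (C′ * (θ * x) ^ k)                           ≈⟨ +-congˡ (-‿cong (*-congˡ (^-congˡ k θx≈))) ⟩
        lower + - (C′ * (- (P * C′)) ^ k)                      ∎
        where lower = φ (+ 2) * B′ * x ^ suc k + - (A * C′) * x ^ k

      x-integral : Integral x
      x-integral = n , below-resp (sym x^n≈)
        (below-+ ℤ-sub (below-+ ℤ-sub
          (below-scale (Integers-* (Integers-* (Integers-φ (+ 2)) (Integers-φ b′))) (below-power x (suc k)))
          (below-scale (Integers-* (-∈ (Integers-* (Integers-φ a) (Integers-φ c′))))
            (below-weaken ℤ-sub (ℕ.n≤1+n (suc k)) (below-power x k))))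
          (below-coefficient ℤ-sub (-∈ (Integers-* (Integers-φ c′)
            (Integers-^ k (-∈ (Integers-* (Integers-φ (+ p)) (Integers-φ c′))))))))
        where
        ℤ-sub = Integers-isSubgroup
        open IsSubgroup ℤ-sub using (-∈)

      p·x∈ : ℤ[θ] (p · x)
      p·x∈ = u-poly , (begin
        p · x          ≈⟨ φ-· p x ⟨
        P * x          ≈⟨ Px≈u ⟩
        u              ≈⟨ eval-u ⟨
        eval θ u-poly  ≈⟨ reflexive (evalℤ≡eval u-poly θ) ⟨
        evalℤ u-poly θ ∎)

      u-poly-monic : MonicOfDegree (suc k) u-poly
      u-poly-monic = +ₚ-monic (X^-monic (suc k)) (DegreeBelow-+ (C a *ₚ X) (C (+ 2 ℤ.* b))
        (DegreeBelow-weaken (C a *ₚ X) (s≤s (s≤s z≤n)) (DegreeBelow-* (C a) X (DegreeBelow-C a) (bounded X-monic)))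
        (DegreeBelow-weaken (C (+ 2 ℤ.* b)) (s≤s z≤n) (DegreeBelow-C _)))
        where open ℤ[X]

      -- If x = g(θ), then u - p (g mod f) has degree < n and vanishes at θ, hence is 0; but
      -- its coefficient of Xⁿ⁻¹ is 1 modulo p.
      x∉ : ¬ ℤ[θ] x
      x∉ (g , x≈) = ¬prime[1] (≡.subst Prime p≡1 p-prime)
        where
        g/f = divide g f-monic
        open Division g/f using () renaming (remainder to r; remainder-bound to r<n)
        open ℤ[X] using (_+ₚ_; coeff)

        h pr : ℤ[X].Poly
        pr = map (ℤ.- (+ p) ℤ.*_) r
        h = u-poly +ₚ pr

        h<n : DegreeBelow n h
        h<n = DegreeBelow-+ u-poly pr (bounded u-poly-monic) (DegreeBelow-map-* (ℤ.- (+ p)) r r<n)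

        x≈r : x ≈ eval θ r
        x≈r = trans x≈ (trans (reflexive (evalℤ≡eval g θ)) (sym (eval-remainder θ g/f eval-f≈0)))

        h[θ]≈0 : evalℤ h θ ≈ 0#
        h[θ]≈0 = begin
          evalℤ h θ                            ≈⟨ reflexive (evalℤ≡eval h θ) ⟩
          eval θ h                             ≈⟨ eval-+ θ u-poly pr ⟩
          eval θ u-poly + eval θ pr            ≈⟨ +-cong eval-u (eval-map-* θ (ℤ.- (+ p)) r) ⟩
          u + φ (ℤ.- (+ p)) * eval θ r         ≈⟨ +-cong (sym Px≈u) (*-cong (-‿homo (+ p)) (sym x≈r)) ⟩
          P * x + - P * x                      ≈⟨ solve 2 (λ p x → p :* x :+ :- p :* x := con (+ 0)) refl P x ⟩
          φ (+ 0)                              ≈⟨ 0#-homo ⟩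
          0#                                   ∎

        h≈0 : ∀ j → fromℤ (coeff h j) ≡ 0ℚ
        h≈0 j = ≡.trans (≡.sym (coeff-map-fromℤ h j))
          (PolynomialsOverℚ.Roots.smallDegreeRoot⇒zero commutativeRing ι-isHomomorphism 1≉0 θ
            (map-fromℤ-monic f-monic) f-irreducible f[θ]≈0
            n (ℤ[X]⇒ℚ[X] h) ℕ.≤-refl (map-fromℤ-degreeBelow h h<n) h[θ]≈0 j)

        -- Position n - 1 is the last one that the bound on the remainder allows and the one where
        -- `u-poly` has its leading 1.
        t = coeff r (suc k)

        1-pt≡0 : + 1 ℤ.+ ℤ.- (+ p) ℤ.* t ≡ + 0
        1-pt≡0 = ≡.trans
          (≡.sym (≡.trans (coeff-+ u-poly pr (suc k)) (≡.cong₂ ℤ._+_ (leading u-poly-monic) (coeff-map-* (ℤ.- (+ p)) r (suc k)))))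
          (fromℤ-injective (h≈0 (suc k)))

        p∣1 : + p ℤ.∣ + 1
        p∣1 = ℕ.divides ℤ.∣ t ∣ (≡.trans (≡.cong ℤ.∣_∣ 1≡t*p) (ℤ.abs-* t (+ p)))
          where
          1≡t*p : + 1 ≡ t ℤ.* + p
          1≡t*p = ℤ.i-j≡0⇒i≡j (+ 1) (t ℤ.* + p) (≡.trans (≡.cong (ℤ._+_ (+ 1))
            (≡.trans (≡.cong ℤ.-_ (ℤ.*-comm t (+ p))) (ℤ.neg-distribˡ-* (+ p) t))) 1-pt≡0)

        p≡1 : p ≡ 1
        p≡1 = ℕ.∣1⇒≡1 p∣1

      divides-index : ∀ {N} → IsIndex N → p ℕ.∣ N
      divides-index = index-divisible p-prime x-integral p·x∈ x∉

proposition6p5 : ∀ {k ℓ₁ ℓ₂} (n : ℕ) (a b c : ℤ) →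
    3 ℕ.≤ n →
    b ℤ.* b ≡ a ℤ.* c →
    IrreducibleOverℚ (quadrinomial n a b c) →
    (K : SimpleExtension k ℓ₁ ℓ₂) →
    SimpleExtension.IsRoot K (quadrinomial n a b c) →
    (p : ℕ) → Prime p →
    (+ p) ℤ.∣ c →
    ¬ ((+ p) ℤ.∣ a) →
    (∀ N → SimpleExtension.IsIndex K N → p ℕ.∣ N) × ¬ SimpleExtension.Monogenic K
proposition6p5 (suc (suc (suc m))) a b c (s≤s (s≤s (s≤s z≤n))) bb≡ac f-irreducible K f[θ]≈0 p p-prime p∣c p∤a
  with prime-squaresℤ {a = a} {b} {c} p-prime bb≡ac p∣c p∤a
-- Matching on the equations turns b and c into b′p and c′p², so the divisibilities are built into f
-- itself.
... | (b′ , ≡.refl) , (c′ , ≡.refl) =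
  (λ N → divides-index {N}) ,
  (λ index-1 → ¬prime[1] (≡.subst Prime (ℕ.∣1⇒≡1 (divides-index index-1)) p-prime))
  where
  divides-index = Extension.NonMonogenic.divides-index K m a b′ c′ p p-prime f-irreducible f[θ]≈0
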